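{- Let ${\sf FinBranch}$ be the following formula about a tree $T\subseteq\omega^{<\omega}$: $$\forall\sigma\in T\ \exists k\ \ |\{n\in\omega:\sigma^\frown n\in T\}|\le k.$$ Then ${\sf FinBranch}$ is $\forall\forall^\infty\forall$-dicomplete.
   Context: Quantifiers range over $\omega$. $\exists^\infty n\,\varphi(n)$ means $\forall m\exists n\ge m\,\varphi(n)$ and $\forall^\infty n\,\varphi(n)$ means $\exists m\forall n\ge m\,\varphi(n)$. A quantifier-pattern is a finite string $\bar{\mathsf Q}=\mathsf Q_0\dots\mathsf Q_\ell$ over $\{\exists,\forall,\exists^\infty,\forall^\infty\}$. A $\bar{\mathsf Q}$-formula is $\varphi(\bar x)\equiv\mathsf Q_0n_0\dots\mathsf Q_\ell n_\ell\,\theta(n_0,\dots,n_\ell,\bar x)$ with $\theta$ a bounded formula. The instance $\bar x$ is a tuple of natural numbers and/or total computable functions (computable elements of $\omega^\omega$). Spaces such as $\omega\times\omega^\omega$, $(\omega^\omega)^\omega$, $\omega^{\omega\times\omega}$ are identified with $\omega^\omega$ by computable pairing. Witnesses: for $\alpha\in\omega^\omega$, $\alpha\Vdash\varphi(\bar x)$ ("$\alpha$ is a witness for $\varphi(\bar x)$") is defined by: $\alpha\Vdash\theta(\bar x)$ iff $\alpha=\bar x$ and $\theta(\bar x)$, for bounded $\theta$; $\langle t,\alpha\rangle\Vdash\exists n\varphi(n,\bar x)$ iff $\alpha\Vdash\varphi(t,\bar x)$; $\alpha\Vdash\forall n\varphi(n,\bar x)$ iff $\alpha(n)\Vdash\varphi(n,\bar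 x)$ for all $n$; $\langle t,\alpha\rangle\Vdash\forall^\infty n\varphi(n,\bar x)$ iff $\alpha(n)\Vdash\varphi(n,\bar x)$ for all $n\ge t$; $\alpha\Vdash\exists^\infty n\varphi(n,\bar x)$ iff for all $n$, writing $\alpha(n)=\langle k,\beta\rangle$, $k\ge n$ and $\beta\Vdash\varphi(k,\bar x)$. Reducibility: $\varphi\le_{\sf m}\psi$ if there are computable functions $\eta,r_-,r_+$ (type-two computable functionals, possibly partial but defined wherever required) such that for every instance $\bar x$: $\varphi(\bar x)$ is true iff $\psi(\eta(\bar x))$ is true; $\alpha\Vdash\varphi(\bar x)$ implies $r_-(\alpha,\bar x)\Vdash\psi(\eta(\bar x))$; $\alpha\Vdash\psi(\eta(\bar x))$ implies $r_+(\alpha,\bar x)\Vdash\varphi(\bar x)$ ($\alpha\in\omega^\omega$ arbitrary). The dual $\varphi^{\sf d}$ of $\mathsf Q_0n_0\dots\mathsf Q_\ell n_\ell\,\theta$ is $\mathsf Q_0^{\sf d}n_0\dots\mathsf Q_\ell^{\sf d}n_\ell\,\neg\theta$, where $\exists^{\sf d}=\forall$, $\forall^{\sf d}=\exists$, $(\exists^\infty)^{\sf d}=\forall^\infty$, $(\forall^\infty)^{\sf d}=\exists^\infty$. $\varphi\le_{\sf dm}\psi$ if $\varphi\le_{\sf m}\psi$ and $\varphi^{\sf d}\le_{\sf m}\psi^{\sf d}$ via a common $\eta$ (the $r_\pm$ may differ). $\varphi$ is strictly $\bar{\mathsf Q}$-dicomplete if it is a $\bar{\mathsf Q}$-formula and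 $\psi\le_{\sf dm}\varphi$ for every $\bar{\mathsf Q}$-formula $\psi$; it is $\bar{\mathsf Q}$-dicomplete if it is $\equiv_{\sf dm}$-equivalent to a strictly $\bar{\mathsf Q}$-dicomplete formula (one such is $\mathsf Q_0n_0\dots\mathsf Q_\ell n_\ell.\ x(n_0,\dots,n_\ell)=0$). Structures: a tree is a subset $T\subseteq\omega^{<\omega}$ (finite sequences, coded by natural numbers) closed under initial segments, given by its characteristic function. Instances of ${\sf FinBranch}$ are (computable) codes of trees; reductions from it need only work on such codes and reductions to it must output such codes. $\sigma^\frown n$ is $\sigma$ extended by the entry $n$. Restricted quantifiers mean $\forall\sigma(\sigma\in T\to\cdots)$ etc., with decidable conditions moved into the innermost bounded part. For a set $A$, $|A|\le k$ abbreviates $\forall c_0,\dots,c_k\in A\ \exists i,j\le k\,(i\ne j\wedge c_i=c_j)$, where the block $\forall c_0,\dots,c_k$ is one universal quantifier over coded tuples. -}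

module Defs where

open import Data.Fin.Base using (Fin; zero; suc; toℕ)
open import Data.Fin.Patterns using (0F; 1F; 2F; 3F)
open import Data.List.Base using (List; []; _∷_; _++_; _∷ʳ_; foldl; map)
open import Data.List.Properties using (foldl-++)
open import Data.Nat.Base
  using (ℕ; zero; suc; pred; _+_; _∸_; _≤_; _≥_; _<_; z≤n; s≤s)
open import Data.Nat.Induction using (<-rec)
open import Data.Nat.Properties
  using (+-assoc; +-comm; +-suc; +-identityʳ; pred[m∸n]≡m∸[1+n]; m≤m+n; ≤-trans;
         n∸n≡0; 0∸n≡0; m+n∸n≡m; suc-injective)
open import Data.Product.Base using (Σ; ∃-syntax; _×_; _,_; proj₁; proj₂)
open import Data.Sum.Base using (_⊎_)
open import Data.Unit.Base using (⊤)
open import Data.Vec.Base using (Vec; []; _∷_; lookup; tabulate)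
open import Data.Vec.Relation.Unary.All using (All)
open import Function.Bundles using (_⇔_)
open import Relation.Binary.PropositionalEquality
  using (_≡_; refl; sym; trans; cong; cong₂; subst; module ≡-Reasoning)
open import Relation.Nullary.Negation using (¬_)

------------------------------------------------------------------------
-- Pairing and coding of finite sequences

triangle : ℕ → ℕ
triangle zero    = 0
triangle (suc n) = suc n + triangle n

pair : ℕ → ℕ → ℕ
pair a b = triangle (a + b) + b

-- The successor in the enumeration of ω × ω given by `pair`.
next : ℕ × ℕ → ℕ × ℕ
next (zero  , b) = suc b , 0
next (suc a , b) = a , suc b

unpair : ℕ → ℕ × ℕ
unpair zero    = 0 , 0
unpair (suc n) = next (unpair n)

π₁ π₂ : ℕ → ℕ
π₁ n = proj₁ (unpair n)
π₂ n = proj₂ (unpair n)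

pair-next : ∀ ab → pair (proj₁ (next ab)) (proj₂ (next ab)) ≡
                   suc (pair (proj₁ ab) (proj₂ ab))
pair-next (zero , b)
  rewrite +-identityʳ b | +-identityʳ (b + triangle b) =
  cong suc (+-comm b (triangle b))
pair-next (suc a , b) rewrite +-suc a b = +-suc (suc (a + b) + triangle (a + b)) b

pair-unpair : ∀ n → pair (π₁ n) (π₂ n) ≡ n
pair-unpair zero    = refl
pair-unpair (suc n) = trans (pair-next (unpair n)) (cong suc (pair-unpair n))

unpair-pair : ∀ a b → unpair (pair a b) ≡ (a , b)
unpair-pair a b = go (a + b) a b refl
  where
  go : ∀ s a b → a + b ≡ s → unpair (pair a b) ≡ (a , b)
  go s a (suc b) eq =
    trans (cong unpair (pair-next (suc a , b)))
          (cong next (go s (suc a) b (trans (sym (+-suc a b)) eq)))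
  go s       zero    zero eq = refl
  go (suc s) (suc a) zero eq =
    trans (cong unpair (pair-next (zero , a)))
          (cong next (go s zero a
            (trans (sym (+-identityʳ a)) (suc-injective eq))))

snoc : ℕ → ℕ → ℕ
snoc s n = suc (pair s n)

-- A bijection between ω^{<ω} and ω for which ⌜ σ ∷ʳ n ⌝ = snoc ⌜ σ ⌝ n.
⌜_⌝ : List ℕ → ℕ
⌜ σ ⌝ = foldl snoc 0 σ

⌜⌝-∷ʳ : ∀ σ n → ⌜ σ ∷ʳ n ⌝ ≡ snoc ⌜ σ ⌝ n
⌜⌝-∷ʳ σ n = foldl-++ snoc 0 σ (n ∷ [])

⌜⌝-surjective : ∀ s → ∃[ σ ] ⌜ σ ⌝ ≡ s
⌜⌝-surjective = <-rec _ step
  where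
  first≤pair : ∀ a b → a ≤ pair a b
  first≤pair a b = ≤-trans (m≤m+n a b)
    (≤-trans (n≤triangle (a + b)) (m≤m+n (triangle (a + b)) b))
    where
    n≤triangle : ∀ n → n ≤ triangle n
    n≤triangle zero    = z≤n
    n≤triangle (suc n) = m≤m+n (suc n) (triangle n)

  step : ∀ s → (∀ {t} → t < s → ∃[ σ ] ⌜ σ ⌝ ≡ t) → ∃[ σ ] ⌜ σ ⌝ ≡ s
  step zero    rec = [] , refl
  step (suc s) rec
    with rec {π₁ s} (s≤s (subst (π₁ s ≤_) (pair-unpair s) (first≤pair (π₁ s) (π₂ s))))
  ... | σ , eq = σ ∷ʳ π₂ s ,
    trans (⌜⌝-∷ʳ σ (π₂ s))
          (trans (cong (λ t → snoc t (π₂ s)) eq) (cong suc (pair-unpair s)))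

drop : ℕ → ℕ → ℕ
drop zero    c = c
drop (suc i) c = π₂ (drop i c)

-- For each k, every c ∈ ω codes the tuple (entry c 0 , … , entry c k), and by
-- entry-tuple every (k+1)-tuple is coded in this way.
entry : ℕ → ℕ → ℕ
entry c i = π₁ (drop i c)

tuple : ∀ {k} → Vec ℕ k → ℕ
tuple []       = 0
tuple (c ∷ cs) = pair c (tuple cs)

entry-tuple : ∀ {k} (cs : Vec ℕ k) i → entry (tuple cs) (toℕ i) ≡ lookup cs i
entry-tuple (c ∷ cs) zero    = cong proj₁ (unpair-pair c (tuple cs))
entry-tuple (c ∷ cs) (suc i) =
  trans (cong π₁ (drop-pair (toℕ i))) (entry-tuple cs i)
  where
  drop-pair : ∀ j → drop (suc j) (pair c (tuple cs)) ≡ drop j (tuple cs)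
  drop-pair zero    = cong proj₂ (unpair-pair c (tuple cs))
  drop-pair (suc j) = cong π₂ (drop-pair j)

------------------------------------------------------------------------
-- Primitive recursive functions

primrec : ∀ {k} → (Vec ℕ k → ℕ) → (Vec ℕ (2 + k) → ℕ) → Vec ℕ (suc k) → ℕ
primrec f g (zero  ∷ xs) = f xs
primrec f g (suc n ∷ xs) = g (n ∷ primrec f g (n ∷ xs) ∷ xs)

data PrimRec : ∀ {k} → (Vec ℕ k → ℕ) → Set where
  zero : PrimRec {0} (λ _ → 0)
  suc  : PrimRec {1} (λ xs → suc (lookup xs 0F))
  proj : ∀ {k} (i : Fin k) → PrimRec {k} (λ xs → lookup xs i)
  comp : ∀ {k l} {f : Vec ℕ k → ℕ} {gs : Fin k → Vec ℕ l → ℕ} →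
         PrimRec f → (∀ i → PrimRec (gs i)) →
         PrimRec (λ xs → f (tabulate (λ i → gs i xs)))
  prec : ∀ {k} {f : Vec ℕ k → ℕ} {g : Vec ℕ (2 + k) → ℕ} →
         PrimRec f → PrimRec g → PrimRec (primrec f g)
  -- Primitive recursiveness is a property of the extension of a function.
  ext  : ∀ {k} {f g : Vec ℕ k → ℕ} → PrimRec f → (∀ xs → f xs ≡ g xs) → PrimRec g

uncurry₁ : (ℕ → ℕ) → Vec ℕ 1 → ℕ
uncurry₁ f xs = f (lookup xs 0F)

uncurry₂ : (ℕ → ℕ → ℕ) → Vec ℕ 2 → ℕ
uncurry₂ f xs = f (lookup xs 0F) (lookup xs 1F)

module _ {k : ℕ} where

  comp₁ : ∀ f {g : Vec ℕ k → ℕ} → PrimRec (uncurry₁ f) → PrimRec g →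
          PrimRec (λ xs → f (g xs))
  comp₁ f {g} pf pg = comp {gs = lookup (g ∷ [])} pf λ { 0F → pg }

  comp₂ : ∀ f {g h : Vec ℕ k → ℕ} → PrimRec (uncurry₂ f) →
          PrimRec g → PrimRec h → PrimRec (λ xs → f (g xs) (h xs))
  comp₂ f {g} {h} pf pg ph =
    comp {gs = lookup (g ∷ h ∷ [])} pf λ { 0F → pg ; 1F → ph }

  suc-pr : ∀ {g : Vec ℕ k → ℕ} → PrimRec g → PrimRec (λ xs → suc (g xs))
  suc-pr = comp₁ suc suc

  const-pr : ∀ c → PrimRec {k} (λ _ → c)
  const-pr zero    = comp {gs = λ ()} zero λ ()
  const-pr (suc c) = suc-pr (const-pr c)

+-pr : PrimRec (uncurry₂ _+_)
+-pr = ext (prec (proj 0F) (suc-pr (proj 1F))) λ { (m ∷ n ∷ []) → eq m n }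
  where
  eq : ∀ m n → primrec (λ xs → lookup xs 0F) (λ xs → suc (lookup xs 1F)) (m ∷ n ∷ []) ≡ m + n
  eq zero    n = refl
  eq (suc m) n = cong suc (eq m n)

pred-pr : PrimRec (uncurry₁ pred)
pred-pr = ext (prec zero (proj 0F)) λ { (zero ∷ []) → refl ; (suc n ∷ []) → refl }

∸-pr : PrimRec (uncurry₂ _∸_)
∸-pr = ext (comp₂ flipped flipped-pr (proj 1F) (proj 0F))
           λ { (m ∷ n ∷ []) → eq n m }
  where
  flipped : ℕ → ℕ → ℕ
  flipped n m = primrec (λ xs → lookup xs 0F) (λ xs → pred (lookup xs 1F)) (n ∷ m ∷ [])

  flipped-pr : PrimRec (uncurry₂ flipped)
  flipped-pr = ext (prec (proj 0F) (comp₁ pred pred-pr (proj 1F))) λ { (_ ∷ _ ∷ []) → refl }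

  eq : ∀ n m → flipped n m ≡ m ∸ n
  eq zero    m = refl
  eq (suc n) m = trans (cong pred (eq n m)) (pred[m∸n]≡m∸[1+n] m n)

triangle-pr : PrimRec (uncurry₁ triangle)
triangle-pr = ext (prec zero (comp₂ _+_ +-pr (suc-pr (proj 0F)) (proj 1F)))
                  λ { (n ∷ []) → eq n }
  where
  eq : ∀ n → primrec (λ _ → 0) (λ xs → suc (lookup xs 0F) + lookup xs 1F) (n ∷ []) ≡ triangle n
  eq zero    = refl
  eq (suc n) = cong (suc n +_) (eq n)

pair-pr : PrimRec (uncurry₂ pair)
pair-pr = comp₂ _+_ +-pr (comp₁ triangle triangle-pr +-pr) (proj 1F)

snoc-pr : PrimRec (uncurry₂ snoc)
snoc-pr = suc-pr pair-pr

-- diagonal n = π₁ n + π₂ n is the largest s with triangle s ≤ n.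
private
  step : ℕ → ℕ → ℕ
  step n s = s + (1 ∸ (triangle (suc s) ∸ suc n))

  diagonal : ℕ → ℕ
  diagonal zero    = 0
  diagonal (suc n) = step n (diagonal n)

  step-next : ∀ a b → step (pair a b) (a + b) ≡ proj₁ (next (a , b)) + proj₂ (next (a , b))
  step-next zero b = trans (cong (λ d → b + (1 ∸ d)) zero-gap)
    (+-suc b 0)
    where
    zero-gap : triangle (suc b) ∸ suc (triangle b + b) ≡ 0
    zero-gap = trans (cong (_∸ (triangle b + b)) (+-comm b (triangle b)))
                     (n∸n≡0 (triangle b + b))
  step-next (suc a) b =
    trans (cong (λ d → suc (a + b) + (1 ∸ d)) gap)
          (trans (cong (suc (a + b) +_) (0∸n≡0 a))
          (trans (+-identityʳ (suc (a + b))) (sym (+-suc a b))))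
    where
    t = triangle (suc (a + b))
    gap : triangle (suc (suc (a + b))) ∸ suc (t + b) ≡ suc a
    gap = begin
      suc (a + b) + t ∸ (t + b)   ≡⟨ cong (_∸ (t + b)) (rearrange a b t) ⟩
      suc a + (t + b) ∸ (t + b)   ≡⟨ m+n∸n≡m (suc a) (t + b) ⟩
      suc a                       ∎
      where
      open ≡-Reasoning
      rearrange : ∀ a b t → suc (a + b) + t ≡ suc a + (t + b)
      rearrange a b t = cong suc (trans (+-assoc a b t) (cong (a +_) (+-comm b t)))

  diagonal-correct : ∀ n → diagonal n ≡ π₁ n + π₂ n
  diagonal-correct zero    = refl
  diagonal-correct (suc n) =
    trans (cong₂ step (sym (pair-unpair n)) (diagonal-correct n))
          (step-next (π₁ n) (π₂ n))

  diagonal-pr : PrimRec (uncurry₁ diagonal)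
  diagonal-pr = ext (prec zero (comp₂ step step-pr (proj 0F) (proj 1F)))
                    λ { (n ∷ []) → eq n }
    where
    step-pr : PrimRec (uncurry₂ step)
    step-pr = comp₂ _+_ +-pr (proj 1F)
      (comp₂ _∸_ ∸-pr (const-pr 1)
        (comp₂ _∸_ ∸-pr (comp₁ triangle triangle-pr (suc-pr (proj 1F))) (suc-pr (proj 0F))))
    eq : ∀ n → primrec (λ _ → 0) (λ xs → step (lookup xs 0F) (lookup xs 1F)) (n ∷ []) ≡ diagonal n
    eq zero    = refl
    eq (suc n) = cong (step n) (eq n)

  π₂-diagonal : ∀ n → n ∸ triangle (diagonal n) ≡ π₂ n
  π₂-diagonal n = begin
    n ∸ triangle (diagonal n)                    ≡⟨ cong (λ s → n ∸ triangle s) (diagonal-correct n) ⟩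
    n ∸ t                                        ≡⟨ cong (_∸ t) (pair-unpair n) ⟨
    t + π₂ n ∸ t                                 ≡⟨ cong (_∸ t) (+-comm t (π₂ n)) ⟩
    π₂ n + t ∸ t                                 ≡⟨ m+n∸n≡m (π₂ n) t ⟩
    π₂ n                                         ∎
    where
    open ≡-Reasoning
    t = triangle (π₁ n + π₂ n)

π₂-pr : PrimRec (uncurry₁ π₂)
π₂-pr = ext (comp₂ _∸_ ∸-pr (proj 0F) (comp₁ triangle triangle-pr (comp₁ diagonal diagonal-pr (proj 0F))))
            λ { (n ∷ []) → π₂-diagonal n }

π₁-pr : PrimRec (uncurry₁ π₁)
π₁-pr = ext (comp₂ _∸_ ∸-pr diagonal-pr π₂-pr)
            λ { (n ∷ []) → trans (cong (_∸ π₂ n) (diagonal-correct n)) (m+n∸n≡m (π₁ n) (π₂ n)) }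

entry-pr : PrimRec (uncurry₂ entry)
entry-pr = comp₁ π₁ π₁-pr (comp₂ drop drop-pr (proj 1F) (proj 0F))
  where
  drop-pr : PrimRec (uncurry₂ drop)
  drop-pr = ext (prec (proj 0F) (comp₁ π₂ π₂-pr (proj 1F))) λ { (i ∷ c ∷ []) → eq i c }
    where
    eq : ∀ i c → primrec (λ xs → lookup xs 0F) (λ xs → π₂ (lookup xs 1F)) (i ∷ c ∷ []) ≡ drop i c
    eq zero    c = refl
    eq (suc i) c = cong π₂ (eq i c)

------------------------------------------------------------------------
-- Computability: partial recursive functions with q oracles

data Code (q : ℕ) : ℕ → Set where
  zero   : Code q 0
  suc    : Code q 1
  proj   : ∀ {k} → Fin k → Code q k
  oracle : Fin q → Code q 1
  comp   : ∀ {k l} → Code q k → Vec (Code q l) k → Code q l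
  prec   : ∀ {k} → Code q k → Code q (2 + k) → Code q (suc k)
  min    : ∀ {k} → Code q (suc k) → Code q k

-- c [ fs ] xs ⇓ y : run with oracles fs on input xs, c halts with output y.
data _[_]_⇓_ {q} : ∀ {k} → Code q k → Vec (ℕ → ℕ) q → Vec ℕ k → ℕ → Set where
  zero   : ∀ {fs} → zero [ fs ] [] ⇓ 0
  suc    : ∀ {fs x} → suc [ fs ] (x ∷ []) ⇓ suc x
  proj   : ∀ {fs k} {xs : Vec ℕ k} i → proj i [ fs ] xs ⇓ lookup xs i
  oracle : ∀ {fs x} i → oracle i [ fs ] (x ∷ []) ⇓ lookup fs i x
  comp   : ∀ {fs k l} {c : Code q k} {ds : Vec (Code q l) k} {xs y}
           (ys : Vec ℕ k) → (∀ i → lookup ds i [ fs ] xs ⇓ lookup ys i) →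
           c [ fs ] ys ⇓ y → comp c ds [ fs ] xs ⇓ y
  prec-z : ∀ {fs k} {c : Code q k} {d xs y} →
           c [ fs ] xs ⇓ y → prec c d [ fs ] (0 ∷ xs) ⇓ y
  prec-s : ∀ {fs k} {c : Code q k} {d xs n r y} →
           prec c d [ fs ] (n ∷ xs) ⇓ r → d [ fs ] (n ∷ r ∷ xs) ⇓ y →
           prec c d [ fs ] (suc n ∷ xs) ⇓ y
  min    : ∀ {fs k} {c : Code q (suc k)} {xs y} →
           c [ fs ] (y ∷ xs) ⇓ 0 →
           (∀ z → z < y → ∃[ w ] c [ fs ] (z ∷ xs) ⇓ suc w) →
           min c [ fs ] xs ⇓ y

-- ω^p × (ω^ω)^q, the tuples of p numbers and q functions.
Space : ℕ → ℕ → Set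
Space p q = Vec ℕ p × Vec (ℕ → ℕ) q

infixr 5 _∷ⁿ_ _∷ᶠ_

_∷ⁿ_ : ∀ {p q} → ℕ → Space p q → Space (suc p) q
n ∷ⁿ (ns , fs) = n ∷ ns , fs

_∷ᶠ_ : ∀ {p q} → (ℕ → ℕ) → Space p q → Space p (suc q)
f ∷ᶠ (ns , fs) = ns , f ∷ fs

-- Codes of partial computable functionals ω^p × (ω^ω)^q → ω^p′ × (ω^ω)^q′: one
-- code for each component, where the argument of an output function is
-- prepended to the numerical inputs.
Functional : (p q p′ q′ : ℕ) → Set
Functional p q p′ q′ = Vec (Code q p) p′ × Vec (Code q (suc p)) q′

-- F maps x ↦ y : F is defined at x (in particular its function outputs are
-- total) with value y.
_maps_↦_ : ∀ {p q p′ q′} → Functional p q p′ q′ → Space p q → Space p′ q′ → Set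
(cs , ds) maps (ns , fs) ↦ (ms , gs) =
  (∀ i → lookup cs i [ fs ] ns ⇓ lookup ms i) ×
  (∀ j n → lookup ds j [ fs ] (n ∷ ns) ⇓ lookup gs j n)

Computable : (ℕ → ℕ) → Set
Computable f = ∃[ c ] ∀ n → c [ [] ] (n ∷ []) ⇓ f n

------------------------------------------------------------------------
-- Bounded formulas with p number and q function variables, in the language
-- with a symbol for each primitive recursive function

data Term (p q : ℕ) : Set where
  var : Fin p → Term p q
  app : Fin q → Term p q → Term p q
  fun : ∀ {k} {f : Vec ℕ k → ℕ} → PrimRec f → Vec (Term p q) k → Term p q

infix  7 _≐_
infixr 6 _∧_
infixr 5 _∨_
infixr 4 _⇒_

data Bounded (p q : ℕ) : Set where
  _≐_         : Term p q → Term p q → Bounded p q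
  not         : Bounded p q → Bounded p q
  _∧_ _∨_ _⇒_ : Bounded p q → Bounded p q → Bounded p q
  all≤ ex≤    : Term p q → Bounded (suc p) q → Bounded p q

mutual
  ⟦_⟧ᵗ : ∀ {p q} → Term p q → Space p q → ℕ
  ⟦ var i ⟧ᵗ          x = lookup (proj₁ x) i
  ⟦ app j t ⟧ᵗ        x = lookup (proj₂ x) j (⟦ t ⟧ᵗ x)
  ⟦ fun {f = f} _ ts ⟧ᵗ x = f (⟦ ts ⟧ᵗˢ x)

  ⟦_⟧ᵗˢ : ∀ {p q k} → Vec (Term p q) k → Space p q → Vec ℕ k
  ⟦ [] ⟧ᵗˢ     x = []
  ⟦ t ∷ ts ⟧ᵗˢ x = ⟦ t ⟧ᵗ x ∷ ⟦ ts ⟧ᵗˢ x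

⟦_⟧ᵇ : ∀ {p q} → Bounded p q → Space p q → Set
⟦ s ≐ t ⟧ᵇ    x = ⟦ s ⟧ᵗ x ≡ ⟦ t ⟧ᵗ x
⟦ not θ ⟧ᵇ    x = ¬ ⟦ θ ⟧ᵇ x
⟦ θ ∧ χ ⟧ᵇ    x = ⟦ θ ⟧ᵇ x × ⟦ χ ⟧ᵇ x
⟦ θ ∨ χ ⟧ᵇ    x = ⟦ θ ⟧ᵇ x ⊎ ⟦ χ ⟧ᵇ x
⟦ θ ⇒ χ ⟧ᵇ    x = ⟦ θ ⟧ᵇ x → ⟦ χ ⟧ᵇ x
⟦ all≤ t θ ⟧ᵇ x = ∀ n → n ≤ ⟦ t ⟧ᵗ x → ⟦ θ ⟧ᵇ (n ∷ⁿ x)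
⟦ ex≤ t θ ⟧ᵇ  x = ∃[ n ] n ≤ ⟦ t ⟧ᵗ x × ⟦ θ ⟧ᵇ (n ∷ⁿ x)

------------------------------------------------------------------------
-- Formulas with a quantifier-pattern

data Quantifier : Set where
  ∃′ ∀′ ∃∞ ∀∞ : Quantifier

Pattern : Set
Pattern = List Quantifier

infixr 5 _∙_

-- Each quantifier binds number variable 0 and shifts the other ones.
data Formula (p q : ℕ) : Pattern → Set where
  matrix : Bounded p q → Formula p q []
  _∙_    : ∀ {Qs} Q → Formula (suc p) q Qs → Formula p q (Q ∷ Qs)

⟦_⟧ : ∀ {p q Qs} → Formula p q Qs → Space p q → Set
⟦ matrix θ ⟧ x = ⟦ θ ⟧ᵇ x
⟦ ∃′ ∙ φ ⟧   x = ∃[ n ] ⟦ φ ⟧ (n ∷ⁿ x)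
⟦ ∀′ ∙ φ ⟧   x = ∀ n → ⟦ φ ⟧ (n ∷ⁿ x)
⟦ ∃∞ ∙ φ ⟧   x = ∀ m → ∃[ n ] n ≥ m × ⟦ φ ⟧ (n ∷ⁿ x)
⟦ ∀∞ ∙ φ ⟧   x = ∃[ m ] ∀ n → n ≥ m → ⟦ φ ⟧ (n ∷ⁿ x)

dualᵠ : Quantifier → Quantifier
dualᵠ ∃′ = ∀′
dualᵠ ∀′ = ∃′
dualᵠ ∃∞ = ∀∞
dualᵠ ∀∞ = ∃∞

dual : ∀ {p q Qs} → Formula p q Qs → Formula p q (map dualᵠ Qs)
dual (matrix θ) = matrix (not θ)
dual (Q ∙ φ)    = dualᵠ Q ∙ dual φ

------------------------------------------------------------------------
-- Witnesses

-- ω × ω^ω ≅ ω^ω : ⟨ t , α ⟩ is t followed by α.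
head : (ℕ → ℕ) → ℕ
head α = α 0

tail : (ℕ → ℕ) → (ℕ → ℕ)
tail α n = α (suc n)

⟨_,_⟩ : ℕ → (ℕ → ℕ) → (ℕ → ℕ)
⟨ t , α ⟩ zero    = t
⟨ t , α ⟩ (suc n) = α n

-- (ω^ω)^ω ≅ ω^{ω×ω} ≅ ω^ω : section α n is the n-th entry of α.
section : (ℕ → ℕ) → ℕ → (ℕ → ℕ)
section α n m = α (pair n m)

-- Finitely many functions are padded with zero functions to an element of
-- (ω^ω)^ω before being joined.
pad : ∀ {q} → Vec (ℕ → ℕ) q → ℕ → (ℕ → ℕ)
pad []       _       _ = 0
pad (f ∷ fs) zero      = f
pad (f ∷ fs) (suc i)   = pad fs i

-- Elements of ω^p × (ω^ω)^q as elements of ω^ω.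
encode : ∀ {p q} → Space p q → (ℕ → ℕ)
encode ([]     , fs) k = pad fs (π₁ k) (π₂ k)
encode (n ∷ ns , fs)   = ⟨ n , encode (ns , fs) ⟩

infix 3 _⊩_at_

_⊩_at_ : ∀ {p q Qs} → (ℕ → ℕ) → Formula p q Qs → Space p q → Set
α ⊩ matrix θ at x = (∀ m → α m ≡ encode x m) × ⟦ θ ⟧ᵇ x
α ⊩ ∃′ ∙ φ   at x = tail α ⊩ φ at head α ∷ⁿ x
α ⊩ ∀′ ∙ φ   at x = ∀ n → section α n ⊩ φ at n ∷ⁿ x
α ⊩ ∃∞ ∙ φ   at x = ∀ n → head (section α n) ≥ n ×
                          (tail (section α n) ⊩ φ at head (section α n) ∷ⁿ x)
α ⊩ ∀∞ ∙ φ   at x = ∀ n → n ≥ head α → section (tail α) n ⊩ φ at n ∷ⁿ x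

------------------------------------------------------------------------
-- Reducibility and completeness

-- A formula whose instances are subject to a condition (such as coding a tree).
record Problem : Set₁ where
  field
    {p q}     : ℕ
    {pattern′} : Pattern
    formula   : Formula p q pattern′
    Valid     : Space p q → Set

  Instance : Space p q → Set
  Instance x = All Computable (proj₂ x) × Valid x

open Problem

unrestricted : ∀ {p q Qs} → Formula p q Qs → Problem
unrestricted φ = record { formula = φ ; Valid = λ _ → ⊤ }

dualᴾ : Problem → Problem
dualᴾ P = record { formula = dual (formula P) ; Valid = Valid P }

record _≤m_via_ (P Q : Problem) (η : Functional (p P) (q P) (p Q) (q Q)) : Set where
  field
    r₋ r₊   : Functional (p P) (suc (q P)) 0 1
    reduces : ∀ x → Instance P x → ∃[ y ]
      η maps x ↦ y ×
      Instance Q y ×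
      (⟦ formula P ⟧ x ⇔ ⟦ formula Q ⟧ y) ×
      (∀ α → α ⊩ formula P at x →
         ∃[ β ] r₋ maps (α ∷ᶠ x) ↦ ([] , β ∷ []) × (β ⊩ formula Q at y)) ×
      (∀ α → α ⊩ formula Q at y →
         ∃[ β ] r₊ maps (α ∷ᶠ x) ↦ ([] , β ∷ []) × (β ⊩ formula P at x))

_≤m_ : Problem → Problem → Set
P ≤m Q = ∃[ η ] P ≤m Q via η

_≤dm_ : Problem → Problem → Set
P ≤dm Q = ∃[ η ] (P ≤m Q via η) × (dualᴾ P ≤m dualᴾ Q via η)

_≡dm_ : Problem → Problem → Set
P ≡dm Q = (P ≤dm Q) × (Q ≤dm P)

StrictlyDicomplete : ∀ {p q} Qs → Formula p q Qs → Set
StrictlyDicomplete Qs φ =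
  ∀ {p′ q′} (ψ : Formula p′ q′ Qs) → unrestricted ψ ≤dm unrestricted φ

Dicomplete : Pattern → Problem → Set
Dicomplete Qs P = ∃[ p ] ∃[ q ] Σ (Formula p q Qs) λ φ →
  StrictlyDicomplete Qs φ × (P ≡dm unrestricted φ)

------------------------------------------------------------------------
-- FinBranch

-- T is the characteristic function, with value 1 on members, of a tree.
IsTree : (ℕ → ℕ) → Set
IsTree T = (∀ s → T s ≤ 1) ×
           (∀ σ τ → T ⌜ σ ++ τ ⌝ ≡ 1 → T ⌜ σ ⌝ ≡ 1)

-- ∀ σ ∃ k ∀ c (σ ∈ T → (∀ i ≤ k) σ⌢cᵢ ∈ T → (∃ i, j ≤ k) (i ≠ j ∧ cᵢ = cⱼ)).
-- With the function variable T, the number variables are 2 = σ, 1 = k, 0 = c in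
-- the matrix, shifted by the bounded quantifiers over i and j.
finBranch : Formula 0 1 (∀′ ∷ ∃′ ∷ ∀′ ∷ [])
finBranch = ∀′ ∙ ∃′ ∙ ∀′ ∙ matrix
  ( member (var 2F)
  ⇒ all≤ (var 1F) (member (child (var 3F) (component (var 1F) (var 0F))))
  ⇒ ex≤ (var 1F) (ex≤ (var 2F)
      ( not (var 1F ≐ var 0F)
      ∧ component (var 2F) (var 1F) ≐ component (var 2F) (var 0F))))
  where
  member : ∀ {p} → Term p 1 → Bounded p 1
  member s = app 0F s ≐ fun (const-pr 1) []

  child component : ∀ {p} → Term p 1 → Term p 1 → Term p 1
  child s n     = fun snoc-pr (s ∷ n ∷ [])
  component c i = fun entry-pr (c ∷ i ∷ [])

FinBranch : Problem
FinBranch = record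
  { formula = finBranch
  ; Valid   = λ (_ , Ts) → IsTree (lookup Ts 0F)
  }

{-# OPTIONS --safe #-}
module Submission where

-- The formula ∀n ∀∞k ∀m. x(n, k, m) = 0 is strictly dicomplete, because bounded
-- formulas are decidable relative to their parameters; FinBranch reduces to it
-- because |A| ≤ k is monotone in k.
--
-- Conversely, x is turned into a tree with an infinite spine 0ⁿ. Its node 0ⁿ has
-- a child, besides 0ⁿ⁺¹, for each i such that x(n, k, m) ≠ 0 for some k ≥ i
-- and some m; the child records i together with the first such (k, m), so that
-- membership in the tree is decidable. These i form an initial segment of ω.
-- If its length is k₀, then x(n, k, m) = 0 for all k ≥ k₀, while 0ⁿ has exactly
-- k₀ + 1 children. A bound on the number of children thus bounds k, and vice versa,
-- whereas using a child for each bad k would make k₀ uncomputable from the bound.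

open import Data.Fin.Base using (Fin; zero; suc; toℕ; fromℕ<; _↑ˡ_; _↑ʳ_)
open import Data.Fin.Patterns using (0F; 1F; 2F)
open import Data.Fin.Properties using (pigeonhole; toℕ<n; toℕ-fromℕ<)
open import Data.List.Base using ([]; _∷_; foldl)
open import Data.List.Properties using (foldl-++)
open import Data.Nat.Base
open import Data.Nat.Properties
open import Data.Product.Base using (Σ; ∃-syntax; _×_; _,_; proj₁; proj₂)
open import Data.Sum.Base using (inj₁; inj₂)
open import Data.Unit.Base using (⊤; tt)
open import Data.Vec.Base as Vec using (Vec; []; _∷_; _++_; lookup; tabulate)
open import Data.Vec.Properties using (lookup∘tabulate; lookup-++ˡ)
open import Data.Vec.Relation.Unary.All using (All)
open import Data.Vec.Relation.Unary.All.Properties using (lookup⁺; lookup⁻)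
open import Function.Base using (id; _∘_)
open import Function.Bundles using (mk⇔)
open import Relation.Binary.Definitions using (tri<; tri≈; tri>)
open import Relation.Binary.PropositionalEquality
open import Relation.Nullary using (¬_; yes; no; contradiction)
open import Relation.Nullary.Decidable using (decidable-stable)
open import Defs

private variable
  E D : Set
  k l p q p′ q′ : ℕ

-- Total computable functionals

infixl 6 _▹

-- `E` is a type of environments and `Γ e` the data that codes may read at `e`. As in a de Bruijn
-- context, `▹` adds a number variable in first place.
_▹ : (E → Space p q) → (E × ℕ → Space (suc p) q)
(Γ ▹) (e , n) = n ∷ⁿ Γ e

-- F e is computed from the numbers and functions Γ e, by a code independent of e.
record Computes (Γ : E → Space p q) (F : E → ℕ) : Set where
  constructor _by_
  field
    code : Code q p
    runs : ∀ e → code [ proj₂ (Γ e) ] proj₁ (Γ e) ⇓ F e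

open Computes

Computes₁ : (E → Space p q) → (E → ℕ → ℕ) → Set
Computes₁ Γ F = Computes (Γ ▹) λ (e , n) → F e n

record Computesˢ (Γ : E → Space p q) (y : E → Space p′ q′) : Set where
  constructor _&_
  field
    numbers   : ∀ i → Computes Γ λ e → lookup (proj₁ (y e)) i
    functions : ∀ j → Computes₁ Γ λ e → lookup (proj₂ (y e)) j

open Computesˢ

ext-computes : {Γ : E → Space p q} {F G : E → ℕ} →
               (∀ e → F e ≡ G e) → Computes Γ F → Computes Γ G
ext-computes eq (c by r) = c by λ e → subst (c [ _ ] _ ⇓_) (eq e) (r e)

comp-tabulate : {c : Code q k} {ds : Fin k → Code q l} {fs : Vec (ℕ → ℕ) q}
                {xs : Vec ℕ l} {ys : Vec ℕ k} {y : ℕ} →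
                (∀ i → ds i [ fs ] xs ⇓ lookup ys i) → c [ fs ] ys ⇓ y →
                comp c (tabulate ds) [ fs ] xs ⇓ y
comp-tabulate {ds = ds} {ys = ys} rs r =
  comp ys (λ i → subst (_[ _ ] _ ⇓ lookup ys i) (sym (lookup∘tabulate ds i)) (rs i)) r

compile : {f : Vec ℕ k → ℕ} → PrimRec f →
          Σ (Code q k) λ c → ∀ fs xs → c [ fs ] xs ⇓ f xs
compile zero = zero , λ { fs [] → zero }
compile suc = suc , λ { fs (x ∷ []) → suc }
compile (proj i) = proj i , λ _ _ → proj i
compile (comp {gs = gs} pf pgs) =
  comp (proj₁ (compile pf)) (tabulate λ i → proj₁ (compile (pgs i))) ,
  λ fs xs → comp-tabulate
    (λ i → subst (proj₁ (compile (pgs i)) [ fs ] xs ⇓_)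
             (sym (lookup∘tabulate (λ i → gs i xs) i)) (proj₂ (compile (pgs i)) fs xs))
    (proj₂ (compile pf) fs (tabulate λ i → gs i xs))
compile {q = q} (prec {f = f} {g = g} pf pg) =
  prec (proj₁ cf) (proj₁ cg) , λ { fs (n ∷ xs) → run fs n xs }
  where
  cf = compile {q = q} pf
  cg = compile {q = q} pg
  run : ∀ fs n xs → prec (proj₁ cf) (proj₁ cg) [ fs ] (n ∷ xs) ⇓ primrec f g (n ∷ xs)
  run fs zero    xs = prec-z (proj₂ cf fs xs)
  run fs (suc n) xs = prec-s (run fs n xs) (proj₂ cg fs _)
compile (ext pf eq) = proj₁ (compile pf) ,
  λ fs xs → subst (proj₁ (compile pf) [ fs ] xs ⇓_) (eq xs) (proj₂ (compile pf) fs xs)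

primRec-computes : {f : Vec ℕ k → ℕ} → PrimRec f →
                   {Γ : E → Space p q} {v : E → Vec ℕ k} →
                   (∀ i → Computes Γ λ e → lookup (v e) i) → Computes Γ λ e → f (v e)
primRec-computes pf cs = comp (proj₁ (compile pf)) (tabulate (code ∘ cs)) by
  λ e → comp-tabulate (λ i → runs (cs i) e) (proj₂ (compile pf) _ _)

-- A code with access to the parameters ys can replace the oracle i by d i, a
-- code that may read these parameters too.
module _ (d : Fin q → Code q′ (suc p)) where

  mutual
    graft : Code q k → Code q′ (k + p)
    graft zero        = comp zero []
    graft suc         = comp suc (proj 0F ∷ [])
    graft (proj i)    = proj (i ↑ˡ p)
    graft (oracle i)  = d i
    -- `graft c` expects the parameters after its own inputs, so projections hand them on.
    graft (comp c ds) = comp (graft c) (grafts ds ++ tabulate λ j → proj (_ ↑ʳ j))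
    graft (prec c e)  = prec (graft c) (graft e)
    graft (min c)     = min (graft c)

    grafts : Vec (Code q k) l → Vec (Code q′ (k + p)) l
    grafts []       = []
    grafts (c ∷ cs) = graft c ∷ grafts cs

  lookup-grafts : ∀ (cs : Vec (Code q k) l) i → lookup (grafts cs) i ≡ graft (lookup cs i)
  lookup-grafts (c ∷ cs) zero    = refl
  lookup-grafts (c ∷ cs) (suc i) = lookup-grafts cs i

  module _ {fs : Vec (ℕ → ℕ) q} {gs : Vec (ℕ → ℕ) q′} {ys : Vec ℕ p}
           (d-runs : ∀ i x → d i [ gs ] (x ∷ ys) ⇓ lookup fs i x) where

    parameters-run : ∀ (xs : Vec ℕ k) j → proj (k ↑ʳ j) [ gs ] (xs ++ ys) ⇓ lookup ys j
    parameters-run xs j = subst (_ [ _ ] _ ⇓_) (eq xs) (proj _)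
      where
      eq : ∀ {k} (xs : Vec ℕ k) → lookup (xs ++ ys) (k ↑ʳ j) ≡ lookup ys j
      eq []       = refl
      eq (x ∷ xs) = eq xs

    append-runs : ∀ (cs : Vec (Code q′ k) l) (zs : Vec ℕ l) {ds : Fin p → Code q′ k} {xs} →
                  (∀ i → lookup cs i [ gs ] xs ⇓ lookup zs i) →
                  (∀ j → ds j [ gs ] xs ⇓ lookup ys j) →
                  ∀ i → lookup (cs ++ tabulate ds) i [ gs ] xs ⇓ lookup (zs ++ ys) i
    append-runs [] [] {ds} rs ss i = subst (_[ _ ] _ ⇓ _) (sym (lookup∘tabulate ds i)) (ss i)
    append-runs (c ∷ cs) (z ∷ zs) rs ss zero    = rs zero
    append-runs (c ∷ cs) (z ∷ zs) rs ss (suc i) = append-runs cs zs (rs ∘ suc) ss i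

    graft-runs : ∀ {c : Code q k} {xs y} → c [ fs ] xs ⇓ y → graft c [ gs ] (xs ++ ys) ⇓ y
    graft-runs zero = comp [] (λ ()) zero
    graft-runs (suc {x = x}) = comp (x ∷ []) (λ { zero → proj 0F }) suc
    graft-runs {xs = xs} (proj i) = subst (_ [ _ ] _ ⇓_) (lookup-++ˡ xs ys i) (proj _)
    graft-runs (oracle i) = d-runs i _
    graft-runs {xs = xs} (comp {ds = ds} zs rs r) = comp (zs ++ ys)
      (append-runs (grafts ds) zs
        (λ i → subst (_[ _ ] _ ⇓ _) (sym (lookup-grafts ds i)) (graft-runs (rs i)))
        (parameters-run xs))
      (graft-runs r)
    graft-runs (prec-z r) = prec-z (graft-runs r)
    graft-runs (prec-s r s) = prec-s (graft-runs r) (graft-runs s)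
    graft-runs (min r rs) = min (graft-runs r) λ z z<y → _ , graft-runs (proj₂ (rs z z<y))

-- Plain composition replaces numbers only. The codes for the functions of `Γ (ρ d)` are grafted in
-- place of the oracles, with the numbers of `Δ d`, which they read, as parameters.
substitute : {Γ : E → Space p q} {Δ : D → Space p′ q′} (ρ : D → E) {F : E → ℕ} →
             Computesˢ Δ (Γ ∘ ρ) → Computes Γ F → Computes Δ (F ∘ ρ)
substitute {Γ = Γ} {Δ} ρ (ns & fs) (c by r) =
  comp (graft (code ∘ fs) c) (tabulate (code ∘ ns) ++ tabulate proj) by λ d →
  comp (proj₁ (Γ (ρ d)) ++ proj₁ (Δ d))
    (append-runs (code ∘ fs) {fs = proj₂ (Γ (ρ d))} (λ i x → runs (fs i) (d , x))
      (tabulate (code ∘ ns)) (proj₁ (Γ (ρ d)))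
      (λ i → subst (_[ _ ] _ ⇓ _) (sym (lookup∘tabulate (code ∘ ns) i)) (runs (ns i) d))
      proj)
    (graft-runs (code ∘ fs) (λ i x → runs (fs i) (d , x)) (r (ρ d)))

module _ {Γ : E → Space p q} where

  newest : Computes (Γ ▹) proj₂
  newest = proj 0F by λ _ → proj 0F

  sameFunctionsˢ : {ns : E → Vec ℕ k} → (∀ i → Computes Γ λ e → lookup (ns e) i) →
                   Computesˢ Γ λ e → ns e , proj₂ (Γ e)
  sameFunctionsˢ cns = cns & λ j → comp (oracle j) (proj 0F ∷ []) by
    λ (e , n) → comp (n ∷ []) (λ { zero → proj 0F }) (oracle j)

  consˢ : {n : E → ℕ} {y : E → Space p′ q′} →
          Computes Γ n → Computesˢ Γ y → Computesˢ Γ λ e → n e ∷ⁿ y e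
  consˢ cn cy = (λ { zero → cn ; (suc i) → numbers cy i }) & functions cy

module _ {Γ : E → Space p q} where

  identityˢ : Computesˢ Γ Γ
  identityˢ = sameFunctionsˢ λ i → proj i by λ _ → proj i

  weakeningˢ : Computesˢ (Γ ▹) (Γ ∘ proj₁)
  weakeningˢ = sameFunctionsˢ λ i → proj (suc i) by λ _ → proj (suc i)

  weakening²ˢ : Computesˢ (Γ ▹ ▹) (Γ ∘ proj₁ ∘ proj₁)
  weakening²ˢ = sameFunctionsˢ λ i → proj (suc (suc i)) by λ _ → proj (suc (suc i))

  weaken : {F : E → ℕ} → Computes Γ F → Computes (Γ ▹) (F ∘ proj₁)
  weaken = substitute proj₁ weakeningˢ

  weakenˢ : {y : E → Space p′ q′} → Computesˢ Γ y → Computesˢ (Γ ▹) (y ∘ proj₁)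
  weakenˢ cy = (λ i → weaken (numbers cy i)) &
    λ j → substitute (λ ((e , _) , n) → e , n) (consˢ newest weakening²ˢ) (functions cy j)

  apply : {F : E → ℕ → ℕ} {a : E → ℕ} →
          Computes₁ Γ F → Computes Γ a → Computes Γ λ e → F e (a e)
  apply {a = a} cF ca = substitute (λ e → e , a e) (consˢ ca identityˢ) cF

  constant : ∀ n → Computes Γ λ _ → n
  constant n = primRec-computes (const-pr n) {v = λ _ → []} λ ()

  app₁ : ∀ f → PrimRec (uncurry₁ f) → {a : E → ℕ} →
         Computes Γ a → Computes Γ λ e → f (a e)
  app₁ f pf {a} ca = primRec-computes pf {v = λ e → a e ∷ []} λ { 0F → ca }

  app₂ : ∀ f → PrimRec (uncurry₂ f) → {a b : E → ℕ} →
         Computes Γ a → Computes Γ b → Computes Γ λ e → f (a e) (b e)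
  app₂ f pf {a} {b} ca cb =
    primRec-computes pf {v = λ e → a e ∷ b e ∷ []} λ { 0F → ca ; 1F → cb }

substituteˢ : {Γ : E → Space p q} {Δ : D → Space k l} (ρ : D → E) {y : E → Space p′ q′} →
              Computesˢ Δ (Γ ∘ ρ) → Computesˢ Γ y → Computesˢ Δ (y ∘ ρ)
substituteˢ ρ cρ cy = (λ i → substitute ρ cρ (numbers cy i)) &
  λ j → substitute (λ (d , n) → ρ d , n) (consˢ newest (weakenˢ cρ)) (functions cy j)

-- Primitive recursion, bounded search, codings

natrec : ℕ → (ℕ → ℕ → ℕ) → ℕ → ℕ
natrec z s zero    = z
natrec z s (suc n) = s n (natrec z s n)

ifz : ℕ → ℕ → ℕ → ℕ
ifz zero    b c = b
ifz (suc _) b c = c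

-- The least i ≤ n with f i ≡ 0, or n if there is none.
search : (ℕ → ℕ) → ℕ → ℕ
search f = natrec 0 λ n r → ifz (f r) r (suc n)

-- The search moves on to `suc n` only when its result for `n` is not a zero; by `search-finds`, no
-- `i ≤ n` is one then.
search-least : ∀ f n {i} → i < search f n → f i ≢ 0
search-finds : ∀ f n {i} → i ≤ n → f i ≡ 0 → f (search f n) ≡ 0

search-least f (suc n) {i} i< eq with f (search f n) in fr
... | zero  = search-least f n i< eq
... | suc _ with () ← trans (sym fr) (search-finds f n (s≤s⁻¹ i<) eq)

search-finds f zero    {zero} z≤n eq = eq
search-finds f (suc n) {i} i≤ eq with f (search f n) in fr
... | zero  = fr
... | suc _ with m≤n⇒m<n∨m≡n i≤
...   | inj₁ i<   with () ← trans (sym fr) (search-finds f n (s≤s⁻¹ i<) eq)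
...   | inj₂ refl = eq

search-≤ : ∀ f n → search f n ≤ n
search-≤ f zero    = z≤n
search-≤ f (suc n) with f (search f n)
... | zero  = m≤n⇒m≤1+n (search-≤ f n)
... | suc _ = ≤-refl

search-unique : ∀ f n {i} → i ≤ n → f i ≡ 0 → (∀ {j} → j < i → f j ≢ 0) → search f n ≡ i
search-unique f n {i} i≤n fi≡0 least with <-cmp (search f n) i
... | tri< r<i _ _ = contradiction (search-finds f n i≤n fi≡0) (least r<i)
... | tri≈ _ eq _  = eq
... | tri> _ _ i<r = contradiction fi≡0 (search-least f n i<r)

-- The pointwise inverse of `section`.
join : (ℕ → ℕ → ℕ) → ℕ → ℕ
join f n = f (π₁ n) (π₂ n)

join-pair : ∀ f m n → join f (pair m n) ≡ f m n
join-pair f m n = cong (λ mn → f (proj₁ mn) (proj₂ mn)) (unpair-pair m n)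

module _ {Γ : E → Space p q} where

  -- The step lives in the context `(e , r) , n` because `prec` passes the index before the previous
  -- value.
  natrec-computes : {z : E → ℕ} {s : E → ℕ → ℕ → ℕ} {n : E → ℕ} →
                    Computes Γ z → Computes (Γ ▹ ▹) (λ ((e , r) , n) → s e n r) →
                    Computes Γ n → Computes Γ λ e → natrec (z e) (s e) (n e)
  natrec-computes {z} {s} (c by rc) (d by rd) = apply (prec c d by λ (e , n) → run e n)
    where
    run : ∀ e n → prec c d [ _ ] (n ∷ _) ⇓ natrec (z e) (s e) n
    run e zero    = prec-z (rc e)
    run e (suc n) = prec-s (run e n) (rd ((e , _) , n))

  ifz-computes : {a b c : E → ℕ} → Computes Γ a → Computes Γ b → Computes Γ c →
                 Computes Γ λ e → ifz (a e) (b e) (c e)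
  ifz-computes {a} {b} {c} ca cb cc = ext-computes (λ e → eq (a e) (b e) (c e))
    (natrec-computes {s = λ e _ _ → c e} cb (weaken (weaken cc)) ca)
    where
    eq : ∀ a b c → natrec b (λ _ _ → c) a ≡ ifz a b c
    eq zero    b c = refl
    eq (suc a) b c = refl

module _ {Γ : E → Space p q} where

  search-computes : {f : E → ℕ → ℕ} {n : E → ℕ} → Computes₁ Γ f → Computes Γ n →
                    Computes Γ λ e → search (f e) (n e)
  search-computes cf = natrec-computes (constant 0)
    (ifz-computes (weaken cf) (weaken newest) (app₁ suc suc newest))

  join-computes : {f : E → ℕ → ℕ → ℕ} → Computes₁ (Γ ▹) (λ (e , m) → f e m) →
                  Computes₁ Γ λ e → join (f e)
  join-computes = substitute (λ (e , n) → (e , π₁ n) , π₂ n)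
    (consˢ (app₁ π₂ π₂-pr newest) (consˢ (app₁ π₁ π₁-pr newest) weakeningˢ))

  ⟨,⟩-computes : {t : E → ℕ} {α : E → ℕ → ℕ} → Computes Γ t → Computes₁ Γ α →
                 Computes₁ Γ λ e → ⟨ t e , α e ⟩
  ⟨,⟩-computes {t} {α} ct cα = ext-computes (λ (e , n) → eq e n)
    (ifz-computes newest (weaken ct)
      (substitute (λ (e , n) → e , pred n) (consˢ (app₁ pred pred-pr newest) weakeningˢ) cα))
    where
    eq : ∀ e n → ifz n (t e) (α e (pred n)) ≡ ⟨ t e , α e ⟩ n
    eq e zero    = refl
    eq e (suc n) = refl

pad-computes : {Γ : E → Space p q} {fs : E → Vec (ℕ → ℕ) l} →
               (∀ j → Computes₁ Γ λ e → lookup (fs e) j) →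
               Computes₁ (Γ ▹) λ (e , i) → pad (fs e) i
pad-computes {l = zero} {fs = fs} cfs = ext-computes (λ ((e , i) , n) → eq (fs e) i n) (constant 0)
  where
  eq : ∀ (fs : Vec (ℕ → ℕ) 0) i n → 0 ≡ pad fs i n
  eq [] i n = refl
pad-computes {l = suc l} {fs = fs} cfs = ext-computes (λ ((e , i) , n) → eq (fs e) i n)
  (ifz-computes (weaken newest)
    (substitute (λ ((e , _) , n) → e , n) (consˢ newest weakening²ˢ) (cfs 0F))
    (substitute (λ ((e , i) , n) → (e , pred i) , n)
      (consˢ newest (consˢ (app₁ pred pred-pr (weaken newest)) weakening²ˢ))
      (pad-computes {fs = Vec.tail ∘ fs}
        λ j → ext-computes (λ (e , n) → lookup-tail (fs e) j n) (cfs (suc j)))))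
  where
  lookup-tail : ∀ (fs : Vec (ℕ → ℕ) (suc l)) j n → lookup fs (suc j) n ≡ lookup (Vec.tail fs) j n
  lookup-tail (_ ∷ _) j n = refl
  eq : ∀ (fs : Vec (ℕ → ℕ) (suc l)) i n →
       ifz i (lookup fs 0F n) (pad (Vec.tail fs) (pred i) n) ≡ pad fs i n
  eq (_ ∷ _) zero    n = refl
  eq (_ ∷ _) (suc i) n = refl

encode-computes : {Γ : E → Space p q} {y : E → Space p′ q′} → Computesˢ Γ y →
                  Computes₁ Γ λ e → encode (y e)
encode-computes {p′ = zero} {y = y} (cns & cfs) = ext-computes (λ (e , n) → eq (y e) n)
  (join-computes (pad-computes {fs = λ e → proj₂ (y e)} cfs))
  where
  eq : ∀ (x : Space 0 _) n → pad (proj₂ x) (π₁ n) (π₂ n) ≡ encode x n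
  eq ([] , _) n = refl
encode-computes {p′ = suc p′} {y = y} (cns & cfs) = ext-computes (λ (e , n) → eq (y e) n)
  (⟨,⟩-computes (cns 0F)
    (encode-computes {y = λ e → Vec.tail (proj₁ (y e)) , proj₂ (y e)}
      ((λ i → ext-computes (λ e → lookup-tail (proj₁ (y e)) i) (cns (suc i))) & cfs)))
  where
  lookup-tail : ∀ (ns : Vec ℕ (suc p′)) i → lookup ns (suc i) ≡ lookup (Vec.tail ns) i
  lookup-tail (_ ∷ _) i = refl
  eq : ∀ (x : Space (suc p′) _) n →
       ⟨ lookup (proj₁ x) 0F , encode (Vec.tail (proj₁ x) , proj₂ x) ⟩ n ≡ encode x n
  eq (_ ∷ _ , _) zero    = refl
  eq (_ ∷ _ , _) (suc n) = refl

-- Witnesses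

-- `section (join f) n` agrees with `f n` only pointwise, so witnesses have to be transported along
-- pointwise equality.
⊩-cong : ∀ {Qs} (φ : Formula p q Qs) {x α β} → (∀ n → α n ≡ β n) → α ⊩ φ at x → β ⊩ φ at x
⊩-cong (matrix θ) eq (leaf , holds) = (λ n → trans (sym (eq n)) (leaf n)) , holds
⊩-cong (∃′ ∙ φ) {x} {β = β} eq w =
  subst (λ n → tail β ⊩ φ at n ∷ⁿ x) (eq 0) (⊩-cong φ (eq ∘ suc) w)
⊩-cong (∀′ ∙ φ) eq w = λ n → ⊩-cong φ (λ m → eq (pair n m)) (w n)
⊩-cong (∃∞ ∙ φ) {x} {β = β} eq w = λ n →
  subst (_≥ n) (eq (pair n 0)) (proj₁ (w n)) ,
  subst (λ m → tail (section β n) ⊩ φ at m ∷ⁿ x) (eq (pair n 0))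
    (⊩-cong φ (λ m → eq (pair n (suc m))) (proj₂ (w n)))
⊩-cong (∀∞ ∙ φ) eq w = λ n n≥ →
  ⊩-cong φ (λ m → eq (suc (pair n m))) (w n (subst (n ≥_) (sym (eq 0)) n≥))

⊩-matrix : {x : Space p q} {θ : Bounded p q} → ⟦ θ ⟧ᵇ x → encode x ⊩ matrix θ at x
⊩-matrix holds = (λ _ → refl) , holds

module _ {p q : ℕ} {Qs : Pattern} {x : Space p q} where

  ⊩-section : {φ : Formula p q Qs} {f : ℕ → ℕ → ℕ} {n : ℕ} →
              f n ⊩ φ at x → section (join f) n ⊩ φ at x
  ⊩-section {φ} {f} {n} = ⊩-cong φ λ m → sym (join-pair f n m)

module _ {p q : ℕ} {Qs : Pattern} {x : Space p q}
         (φ : Formula (suc p) q Qs) (f : ℕ → ℕ → ℕ) where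

  ⊩-∀ : (∀ n → f n ⊩ φ at n ∷ⁿ x) → join f ⊩ ∀′ ∙ φ at x
  ⊩-∀ w n = ⊩-section {φ = φ} {f} (w n)

  ⊩-∀∞ : ∀ t → (∀ n → n ≥ t → f n ⊩ φ at n ∷ⁿ x) → ⟨ t , join f ⟩ ⊩ ∀∞ ∙ φ at x
  ⊩-∀∞ t w n n≥t = ⊩-section {φ = φ} {f} (w n n≥t)

  ⊩-∃∞ : (∀ n → f n 0 ≥ n) → (∀ n → f n ⊩ ∃′ ∙ φ at x) → join f ⊩ ∃∞ ∙ φ at x
  ⊩-∃∞ ≥n w n = subst (_≥ n) (sym (join-pair f n 0)) (≥n n) ,
                ⊩-section {φ = ∃′ ∙ φ} {f} {n} (w n)

⊩-sound : ∀ {Qs} (φ : Formula p q Qs) {x α} → α ⊩ φ at x → ⟦ φ ⟧ x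
⊩-sound (matrix θ) (_ , holds) = holds
⊩-sound (∃′ ∙ φ) w = _ , ⊩-sound φ w
⊩-sound (∀′ ∙ φ) w n = ⊩-sound φ (w n)
⊩-sound (∃∞ ∙ φ) w m = _ , proj₁ (w m) , ⊩-sound φ (proj₂ (w m))
⊩-sound (∀∞ ∙ φ) w = _ , λ n n≥ → ⊩-sound φ (w n n≥)

⊩-complete : ∀ {Qs} (φ : Formula p q Qs) {x} → ⟦ φ ⟧ x → ∃[ α ] α ⊩ φ at x
⊩-complete (matrix θ) {x} holds = encode x , ⊩-matrix {θ = θ} holds
⊩-complete (∃′ ∙ φ) (n , t) = let α , w = ⊩-complete φ t in ⟨ n , α ⟩ , w
⊩-complete (∀′ ∙ φ) t =
  let f = λ n → proj₁ (⊩-complete φ (t n)) in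
  join f , ⊩-∀ φ f λ n → proj₂ (⊩-complete φ (t n))
⊩-complete (∃∞ ∙ φ) t =
  let f = λ m → let n , _ , s = t m in ⟨ n , proj₁ (⊩-complete φ s) ⟩ in
  join f , ⊩-∃∞ φ f (λ m → proj₁ (proj₂ (t m)))
                     (λ m → proj₂ (⊩-complete φ (proj₂ (proj₂ (t m)))))
⊩-complete (∀∞ ∙ φ) {x} (m , t) =
  ⟨ m , join (proj₁ ∘ branch) ⟩ , ⊩-∀∞ φ (proj₁ ∘ branch) m (proj₂ ∘ branch)
  where
  branch : ∀ n → ∃[ α ] (n ≥ m → α ⊩ φ at n ∷ⁿ x)
  branch n with m ≤? n
  ... | yes n≥m = let α , w = ⊩-complete φ (t n n≥m) in α , λ _ → w
  -- Below the threshold any function will do.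
  ... | no  n≱m = (λ _ → 0) , λ n≥m → contradiction n≥m n≱m

-- Reductions

open Problem renaming (p to #numbers; q to #functions)

functional : {h : Space p q → Space p′ q′} → Computesˢ id h → Functional p q p′ q′
functional (cns & cfs) = tabulate (code ∘ cns) , tabulate (code ∘ cfs)

functional-maps : {h : Space p q → Space p′ q′} (ch : Computesˢ id h) →
                  ∀ x → functional ch maps x ↦ h x
functional-maps (cns & cfs) x =
  (λ i → subst (_[ _ ] _ ⇓ _) (sym (lookup∘tabulate (code ∘ cns) i)) (runs (cns i) x)) ,
  (λ j n → subst (_[ _ ] _ ⇓ _) (sym (lookup∘tabulate (code ∘ cfs) j)) (runs (cfs j) (x , n)))

-- For a fixed `x` the numbers are constants and the functions have oracle-free codes; substituting
-- both into the codes for `h` leaves no oracle.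
computable-image : {h : Space p q → Space p′ q′} → Computesˢ id h →
                   ∀ {x} → All Computable (proj₂ x) → All Computable (proj₂ (h x))
computable-image {h = h} ch {x} cx = lookup⁻ λ j →
  let c by r = functions relative j in c , λ n → r (tt , n)
  where
  relative : Computesˢ {E = ⊤} (λ _ → [] , []) λ _ → h x
  relative = substituteˢ (λ _ → x)
    ((λ i → constant _) & λ j → let c , r = lookup⁺ cx j in c by λ (_ , n) → r n) ch

withWitness : (ℕ → ℕ) × Space p q → Space p (suc q)
withWitness (α , x) = α ∷ᶠ x

witness-computes : Computes₁ (withWitness {p} {q}) proj₁
witness-computes = comp (oracle 0F) (proj 0F ∷ []) by
  λ (_ , n) → comp (n ∷ []) (λ { zero → proj 0F }) (oracle 0F)

instanceˢ : Computesˢ (withWitness {p} {q}) proj₂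
instanceˢ = (λ i → proj i by λ _ → proj i) & λ j → comp (oracle (suc j)) (proj 0F ∷ []) by
  λ (_ , n) → comp (n ∷ []) (λ { zero → proj 0F }) (oracle (suc j))

-- Realisers suffice: by countable choice, a true formula has a witness.
reduction : ∀ {P Q} {h : Space (#numbers P) (#functions P) → Space (#numbers Q) (#functions Q)}
            (ch : Computesˢ id h)
            (r₋ r₊ : (ℕ → ℕ) × Space (#numbers P) (#functions P) → ℕ → ℕ) →
            Computes₁ withWitness r₋ → Computes₁ withWitness r₊ →
            (∀ x → Valid P x → Valid Q (h x)) →
            (∀ x → Valid P x → ∀ α → α ⊩ formula P at x → r₋ (α , x) ⊩ formula Q at h x) →
            (∀ x → Valid P x → ∀ α → α ⊩ formula Q at h x → r₊ (α , x) ⊩ formula P at x) →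
            P ≤m Q via functional ch
reduction {P} {Q} {h} ch r₋ r₊ c₋ c₊ valid to from = record
  { r₋ = [] , code c₋ ∷ []
  ; r₊ = [] , code c₊ ∷ []
  ; reduces = λ x (computable , v) →
      h x , functional-maps ch x , (computable-image ch computable , valid x v) ,
      mk⇔ (λ t → let α , w = ⊩-complete (formula P) t in ⊩-sound (formula Q) (to x v α w))
          (λ t → let α , w = ⊩-complete (formula Q) t in ⊩-sound (formula P) (from x v α w)) ,
      (λ α w → r₋ (α , x) , ((λ ()) , λ { zero n → runs c₋ ((α , x) , n) }) , to x v α w) ,
      (λ α w → r₊ (α , x) , ((λ ()) , λ { zero n → runs c₊ ((α , x) , n) }) , from x v α w)
  }

-- Bounded formulas

mutual
  term-computes : (t : Term p q) → Computes id λ x → ⟦ t ⟧ᵗ x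
  term-computes (var i)    = proj i by λ _ → proj i
  term-computes (app j t)  = apply (functions identityˢ j) (term-computes t)
  term-computes (fun f ts) = primRec-computes f (terms-compute ts)

  terms-compute : (ts : Vec (Term p q) k) → ∀ i → Computes id λ x → lookup (⟦ ts ⟧ᵗˢ x) i
  terms-compute (t ∷ ts) zero    = term-computes t
  terms-compute (t ∷ ts) (suc i) = terms-compute ts i

distance : ℕ → ℕ → ℕ
distance m n = (m ∸ n) + (n ∸ m)

negate : ℕ → ℕ
negate m = ifz m 1 0

-- ⟦ θ ⟧ᵇ x is represented by test θ x ≡ 0.
test : Bounded p q → Space p q → ℕ
test (s ≐ t)    x = distance (⟦ s ⟧ᵗ x) (⟦ t ⟧ᵗ x)
test (not θ)    x = negate (test θ x)
test (θ ∧ χ)    x = test θ x + test χ x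
test (θ ∨ χ)    x = ifz (test θ x) 0 (test χ x)
test (θ ⇒ χ)    x = ifz (test θ x) (test χ x) 0
-- This is the test of `not (ex≤ t (not θ))`: the search looks for a counterexample.
test (all≤ t θ) x =
  negate (negate (test θ (search (λ n → negate (test θ (n ∷ⁿ x))) (⟦ t ⟧ᵗ x) ∷ⁿ x)))
test (ex≤ t θ)  x = test θ (search (λ n → test θ (n ∷ⁿ x)) (⟦ t ⟧ᵗ x) ∷ⁿ x)

distance≡0⇒≡ : ∀ m n → distance m n ≡ 0 → m ≡ n
distance≡0⇒≡ m n eq = ≤-antisym (m∸n≡0⇒m≤n (m+n≡0⇒m≡0 (m ∸ n) eq))
                                (m∸n≡0⇒m≤n (m+n≡0⇒n≡0 (m ∸ n) eq))

distance-refl : ∀ n → distance n n ≡ 0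
distance-refl n = cong₂ _+_ (n∸n≡0 n) (n∸n≡0 n)

negate-sound : ∀ n → negate n ≡ 0 → n ≢ 0
negate-sound (suc n) _ ()

negate-complete : ∀ n → n ≢ 0 → negate n ≡ 0
negate-complete zero    n≢0 = contradiction refl n≢0
negate-complete (suc n) _   = refl

mutual
  -- Soundness and completeness depend on each other because `not` and the premise of `⇒` reverse
  -- the direction.
  test-sound : (θ : Bounded p q) → ∀ {x} → test θ x ≡ 0 → ⟦ θ ⟧ᵇ x
  test-sound (s ≐ t) = distance≡0⇒≡ _ _
  test-sound (not θ) {x} eq h = negate-sound (test θ x) eq (test-complete θ h)
  test-sound (θ ∧ χ) {x} eq = test-sound θ (m+n≡0⇒m≡0 (test θ x) eq) ,
                              test-sound χ (m+n≡0⇒n≡0 (test θ x) eq)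
  test-sound (θ ∨ χ) {x} eq with test θ x in θx
  ... | zero  = inj₁ (test-sound θ θx)
  ... | suc _ = inj₂ (test-sound χ eq)
  test-sound (θ ⇒ χ) {x} eq h rewrite test-complete θ h = test-sound χ eq
  -- If the test failed at `n`, the search would end at a counterexample, against `eq`. Decidability
  -- of equality with 0 removes the double negation.
  test-sound (all≤ t θ) {x} eq n n≤ = test-sound θ (¬¬-elim n λ ≢0 →
    negate-sound _ eq
      (search-finds (λ n → negate (test θ (n ∷ⁿ x))) _ n≤ (negate-complete _ ≢0)))
    where
    ¬¬-elim : ∀ n → ¬ test θ (n ∷ⁿ x) ≢ 0 → test θ (n ∷ⁿ x) ≡ 0
    ¬¬-elim n ¬≢ = decidable-stable (_ ≟ 0) ¬≢
  test-sound (ex≤ t θ) {x} eq =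
    _ , search-≤ (λ n → test θ (n ∷ⁿ x)) (⟦ t ⟧ᵗ x) , test-sound θ eq

  test-complete : (θ : Bounded p q) → ∀ {x} → ⟦ θ ⟧ᵇ x → test θ x ≡ 0
  test-complete (s ≐ t) {x} eq =
    trans (cong (distance (⟦ s ⟧ᵗ x)) (sym eq)) (distance-refl (⟦ s ⟧ᵗ x))
  test-complete (not θ) ¬h = negate-complete _ (¬h ∘ test-sound θ)
  test-complete (θ ∧ χ) (h , h′) = cong₂ _+_ (test-complete θ h) (test-complete χ h′)
  test-complete (θ ∨ χ) (inj₁ h) rewrite test-complete θ h = refl
  test-complete (θ ∨ χ) {x} (inj₂ h) with test θ x
  ... | zero  = refl
  ... | suc _ = test-complete χ h
  test-complete (θ ⇒ χ) {x} h with test θ x in θx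
  ... | zero  = test-complete χ (h (test-sound θ θx))
  ... | suc _ = refl
  test-complete (all≤ t θ) {x} h = negate-complete _ λ eq → negate-sound _ eq
    (test-complete θ (h _ (search-≤ (λ n → negate (test θ (n ∷ⁿ x))) (⟦ t ⟧ᵗ x))))
  test-complete (ex≤ t θ) {x} (n , n≤ , h) =
    search-finds (λ n → test θ (n ∷ⁿ x)) _ n≤ (test-complete θ h)

module _ {Γ : E → Space p q} where

  negate-computes : {m : E → ℕ} → Computes Γ m → Computes Γ λ e → negate (m e)
  negate-computes cm = ifz-computes cm (constant 1) (constant 0)

  distance-computes : {m n : E → ℕ} → Computes Γ m → Computes Γ n →
                      Computes Γ λ e → distance (m e) (n e)
  distance-computes cm cn = app₂ _+_ +-pr (app₂ _∸_ ∸-pr cm cn) (app₂ _∸_ ∸-pr cn cm)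

reindex : {Γ : E → Space p q} {F : Space p q → ℕ} → Computes id F → Computes Γ (F ∘ Γ)
reindex {Γ = Γ} (c by r) = c by λ e → r (Γ e)

test-computes : (θ : Bounded p q) → Computes id (test θ)
test-computes (s ≐ t)    = distance-computes (term-computes s) (term-computes t)
test-computes (not θ)    = negate-computes (test-computes θ)
test-computes (θ ∧ χ)    = app₂ _+_ +-pr (test-computes θ) (test-computes χ)
test-computes (θ ∨ χ)    = ifz-computes (test-computes θ) (constant 0) (test-computes χ)
test-computes (θ ⇒ χ)    = ifz-computes (test-computes θ) (test-computes χ) (constant 0)
test-computes (all≤ t θ) = negate-computes (negate-computes (apply body
  (search-computes (negate-computes body) (term-computes t))))
  where
  body : Computes₁ id λ x n → test θ (n ∷ⁿ x)
  body = reindex {Γ = id ▹} (test-computes θ)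
test-computes (ex≤ t θ)  = apply body (search-computes body (term-computes t))
  where
  body : Computes₁ id λ x n → test θ (n ∷ⁿ x)
  body = reindex {Γ = id ▹} (test-computes θ)

-- Witnesses for three quantifiers

-- Universal quantifiers and the matrix leave no choice beyond coding the instance, so such a
-- witness amounts to the bounds `κ`. A dual one amounts to a number `n` with choices `μ`, and `κ`
-- in the case of `∃∞`.
∀∀∞∀-witness ∀∃∀-witness : (ℕ → ℕ) → Space p q → ℕ → ℕ
∀∀∞∀-witness κ x = join λ n → ⟨ κ n , join (λ k → join λ m → encode (m ∷ⁿ k ∷ⁿ n ∷ⁿ x)) ⟩
∀∃∀-witness  κ x = join λ n → ⟨ κ n , join (λ m → encode (m ∷ⁿ κ n ∷ⁿ n ∷ⁿ x)) ⟩

∃∃∞∃-witness : ℕ → (ℕ → ℕ) → (ℕ → ℕ) → Space p q → ℕ → ℕ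
∃∃∞∃-witness n κ μ x =
  ⟨ n , join (λ i → ⟨ κ i , ⟨ μ i , encode (μ i ∷ⁿ κ i ∷ⁿ n ∷ⁿ x) ⟩ ⟩) ⟩

∃∀∃-witness : ℕ → (ℕ → ℕ) → Space p q → ℕ → ℕ
∃∀∃-witness n μ x = ⟨ n , join (λ k → ⟨ μ k , encode (μ k ∷ⁿ k ∷ⁿ n ∷ⁿ x) ⟩) ⟩

module _ (x : Space p q) (θ : Bounded (3 + p) q) where

  ⊩-∀∀∞∀ : ∀ κ → (∀ n k → k ≥ κ n → ∀ m → ⟦ θ ⟧ᵇ (m ∷ⁿ k ∷ⁿ n ∷ⁿ x)) →
           ∀∀∞∀-witness κ x ⊩ ∀′ ∙ ∀∞ ∙ ∀′ ∙ matrix θ at x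
  ⊩-∀∀∞∀ κ h =
    ⊩-∀ (∀∞ ∙ ∀′ ∙ matrix θ)
        (λ n → ⟨ κ n , join (λ k → join λ m → encode (m ∷ⁿ k ∷ⁿ n ∷ⁿ x)) ⟩) λ n →
    ⊩-∀∞ (∀′ ∙ matrix θ) (λ k → join λ m → encode (m ∷ⁿ k ∷ⁿ n ∷ⁿ x)) (κ n) λ k k≥ →
    ⊩-∀ (matrix θ) (λ m → encode (m ∷ⁿ k ∷ⁿ n ∷ⁿ x)) λ m →
    ⊩-matrix {θ = θ} (h n k k≥ m)

  ⊩-∀∃∀ : ∀ κ → (∀ n m → ⟦ θ ⟧ᵇ (m ∷ⁿ κ n ∷ⁿ n ∷ⁿ x)) →
          ∀∃∀-witness κ x ⊩ ∀′ ∙ ∃′ ∙ ∀′ ∙ matrix θ at x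
  ⊩-∀∃∀ κ h =
    ⊩-∀ (∃′ ∙ ∀′ ∙ matrix θ)
        (λ n → ⟨ κ n , join (λ m → encode (m ∷ⁿ κ n ∷ⁿ n ∷ⁿ x)) ⟩) λ n →
    ⊩-∀ (matrix θ) (λ m → encode (m ∷ⁿ κ n ∷ⁿ n ∷ⁿ x)) λ m →
    ⊩-matrix {θ = θ} (h n m)

  ⊩-∃∃∞∃ : ∀ n κ μ → (∀ i → κ i ≥ i) → (∀ i → ⟦ θ ⟧ᵇ (μ i ∷ⁿ κ i ∷ⁿ n ∷ⁿ x)) →
           ∃∃∞∃-witness n κ μ x ⊩ ∃′ ∙ ∃∞ ∙ ∃′ ∙ matrix θ at x
  ⊩-∃∃∞∃ n κ μ ≥i h = ⊩-∃∞ (∃′ ∙ matrix θ)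
    (λ i → ⟨ κ i , ⟨ μ i , encode (μ i ∷ⁿ κ i ∷ⁿ n ∷ⁿ x) ⟩ ⟩)
    ≥i λ i → ⊩-matrix {θ = θ} (h i)

  ⊩-∃∀∃ : ∀ n μ → (∀ k → ⟦ θ ⟧ᵇ (μ k ∷ⁿ k ∷ⁿ n ∷ⁿ x)) →
          ∃∀∃-witness n μ x ⊩ ∃′ ∙ ∀′ ∙ ∃′ ∙ matrix θ at x
  ⊩-∃∀∃ n μ h = ⊩-∀ (∃′ ∙ matrix θ)
    (λ k → ⟨ μ k , encode (μ k ∷ⁿ k ∷ⁿ n ∷ⁿ x) ⟩) λ k → ⊩-matrix {θ = θ} (h k)

module _ {Γ : E → Space p q} {x : E → Space p′ q′} (cx : Computesˢ Γ x) where

  ∀∀∞∀-computes : {κ : E → ℕ → ℕ} → Computes₁ Γ κ →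
                  Computes₁ Γ λ e → ∀∀∞∀-witness (κ e) (x e)
  ∀∀∞∀-computes cκ = join-computes (⟨,⟩-computes cκ (join-computes (join-computes
    (encode-computes (consˢ newest (consˢ (weaken newest) (consˢ (weaken (weaken newest))
      (weakenˢ (weakenˢ (weakenˢ cx))))))))))

  ∀∃∀-computes : {κ : E → ℕ → ℕ} → Computes₁ Γ κ →
                 Computes₁ Γ λ e → ∀∃∀-witness (κ e) (x e)
  ∀∃∀-computes cκ = join-computes (⟨,⟩-computes cκ (join-computes
    (encode-computes (consˢ newest (consˢ (weaken cκ) (consˢ (weaken newest)
      (weakenˢ (weakenˢ cx))))))))

  ∃∃∞∃-computes : {n : E → ℕ} {κ μ : E → ℕ → ℕ} →
                  Computes Γ n → Computes₁ Γ κ → Computes₁ Γ μ →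
                  Computes₁ Γ λ e → ∃∃∞∃-witness (n e) (κ e) (μ e) (x e)
  ∃∃∞∃-computes cn cκ cμ = ⟨,⟩-computes cn (join-computes (⟨,⟩-computes cκ (⟨,⟩-computes cμ
    (encode-computes (consˢ cμ (consˢ cκ (consˢ (weaken cn) (weakenˢ cx))))))))

  ∃∀∃-computes : {n : E → ℕ} {μ : E → ℕ → ℕ} → Computes Γ n → Computes₁ Γ μ →
                 Computes₁ Γ λ e → ∃∀∃-witness (n e) (μ e) (x e)
  ∃∀∃-computes cn cμ = ⟨,⟩-computes cn (join-computes (⟨,⟩-computes cμ
    (encode-computes (consˢ cμ (consˢ newest (consˢ (weaken cn) (weakenˢ cx)))))))

witness-at : {i : (ℕ → ℕ) × Space p q → ℕ → ℕ} → Computes₁ withWitness i →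
             Computes₁ withWitness λ e n → proj₁ e (i e n)
witness-at {i = i} ci =
  substitute (λ (e , n) → e , i e n) (consˢ ci weakeningˢ) witness-computes

-- bound reads off the bound on k in a witness for ∀∃∀ or ∀∀∞∀; inner and inner₂
-- read off k and m in one for ∃∃∞∃, and inner reads off m in one for ∃∀∃.
bound inner inner₂ : (ℕ → ℕ) → ℕ → ℕ
bound  α n = α (pair n 0)
inner  α i = α (suc (pair i 0))
inner₂ α i = α (suc (pair i 1))

bound-computes : Computes₁ (withWitness {p} {q}) λ (α , _) → bound α
bound-computes = witness-at (app₂ pair pair-pr newest (constant 0))

head-computes : Computes (withWitness {p} {q}) λ (α , _) → head α
head-computes = apply witness-computes (constant 0)

inner-computes : Computes₁ (withWitness {p} {q}) λ (α , _) → inner α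
inner-computes = witness-at (app₁ suc suc (app₂ pair pair-pr newest (constant 0)))

inner₂-computes : Computes₁ (withWitness {p} {q}) λ (α , _) → inner₂ α
inner₂-computes = witness-at (app₁ suc suc (app₂ pair pair-pr newest (constant 1)))

-- The complete formula

θᵘ : Bounded 3 1
θᵘ = app 0F (fun pair-pr (fun pair-pr (var 2F ∷ var 1F ∷ []) ∷ var 0F ∷ [])) ≐ fun (const-pr 0) []

universal : Formula 0 1 (∀′ ∷ ∀∞ ∷ ∀′ ∷ [])
universal = ∀′ ∙ ∀∞ ∙ ∀′ ∙ matrix θᵘ

module _ (θ : Bounded (3 + p) q) where

  table : Space p q → ℕ → ℕ
  table x = join λ nk m → test θ (m ∷ⁿ π₂ nk ∷ⁿ π₁ nk ∷ⁿ x)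

  tableInstance : Space p q → Space 0 1
  tableInstance x = [] , table x ∷ []

  table-pair : ∀ x n k m → table x (pair (pair n k) m) ≡ test θ (m ∷ⁿ k ∷ⁿ n ∷ⁿ x)
  table-pair x n k m = trans
    (join-pair (λ nk m → test θ (m ∷ⁿ π₂ nk ∷ⁿ π₁ nk ∷ⁿ x)) (pair n k) m)
    (cong (λ nk → test θ (m ∷ⁿ proj₂ nk ∷ⁿ proj₁ nk ∷ⁿ x)) (unpair-pair n k))

  table-sound : ∀ x n k m → table x (pair (pair n k) m) ≡ 0 → ⟦ θ ⟧ᵇ (m ∷ⁿ k ∷ⁿ n ∷ⁿ x)
  table-sound x n k m eq = test-sound θ (trans (sym (table-pair x n k m)) eq)

  table-complete : ∀ x n k m → ⟦ θ ⟧ᵇ (m ∷ⁿ k ∷ⁿ n ∷ⁿ x) → table x (pair (pair n k) m) ≡ 0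
  table-complete x n k m h = trans (table-pair x n k m) (test-complete θ h)

  tableInstance-computes : Computesˢ id tableInstance
  tableInstance-computes = (λ ()) & λ { 0F → join-computes {Γ = id}
    (substitute (λ ((x , nk) , m) → m ∷ⁿ π₂ nk ∷ⁿ π₁ nk ∷ⁿ x)
      (consˢ newest (consˢ (app₁ π₂ π₂-pr (weaken newest)) (consˢ (app₁ π₁ π₁-pr (weaken newest))
        weakening²ˢ)))
      (test-computes θ)) }

-- The table vanishes exactly where `θ` holds, so bounds and counterexamples carry over unchanged in
-- both directions. Only the leaves, which code the instance, are rebuilt.
universal-strictlyDicomplete : StrictlyDicomplete (∀′ ∷ ∀∞ ∷ ∀′ ∷ []) universal
universal-strictlyDicomplete (∀′ ∙ ∀∞ ∙ ∀′ ∙ matrix θ) =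
  functional cy ,
  reduction {unrestricted ψ} {unrestricted universal} cy
    (λ (α , x) → ∀∀∞∀-witness (bound α) (tableInstance θ x))
    (λ (α , x) → ∀∀∞∀-witness (bound α) x)
    (∀∀∞∀-computes image bound-computes) (∀∀∞∀-computes instanceˢ bound-computes)
    _
    (λ x _ α w → ⊩-∀∀∞∀ (tableInstance θ x) θᵘ (bound α) λ n k k≥ m →
      table-complete θ x n k m (proj₂ (w n k k≥ m)))
    (λ x _ α w → ⊩-∀∀∞∀ x θ (bound α) λ n k k≥ m →
      table-sound θ x n k m (proj₂ (w n k k≥ m))) ,
  reduction {dualᴾ (unrestricted ψ)} {dualᴾ (unrestricted universal)} cy
    (λ (α , x) → ∃∃∞∃-witness (head α) (inner α) (inner₂ α) (tableInstance θ x))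
    (λ (α , x) → ∃∃∞∃-witness (head α) (inner α) (inner₂ α) x)
    (∃∃∞∃-computes image head-computes inner-computes inner₂-computes)
    (∃∃∞∃-computes instanceˢ head-computes inner-computes inner₂-computes)
    _
    (λ x _ α w → ⊩-∃∃∞∃ (tableInstance θ x) (not θᵘ) (head α) (inner α) (inner₂ α)
      (proj₁ ∘ w) λ i →
      proj₂ (proj₂ (w i)) ∘ table-sound θ x (head α) (inner α i) (inner₂ α i))
    (λ x _ α w → ⊩-∃∃∞∃ x (not θ) (head α) (inner α) (inner₂ α)
      (proj₁ ∘ w) λ i →
      proj₂ (proj₂ (w i)) ∘ table-complete θ x (head α) (inner α i) (inner₂ α i))
  where
  ψ = ∀′ ∙ ∀∞ ∙ ∀′ ∙ matrix θ
  cy = tableInstance-computes θ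
  image : Computesˢ withWitness (tableInstance θ ∘ proj₂)
  image = substituteˢ proj₂ instanceˢ cy

-- Finitely branching trees

kernel : ∀ {Q₀ Q₁ Q₂} → Formula p q (Q₀ ∷ Q₁ ∷ Q₂ ∷ []) → Bounded (3 + p) q
kernel (_ ∙ _ ∙ _ ∙ matrix θ) = θ

θᶠ : Bounded 3 1
θᶠ = kernel finBranch

-- One `c` codes tuples of every length, so a coincidence among the entries up to `k` is also one
-- among the entries up to `k′`.
θᶠ-mono : ∀ x c s {k k′} → k ≤ k′ →
          ⟦ θᶠ ⟧ᵇ (c ∷ⁿ k ∷ⁿ s ∷ⁿ x) → ⟦ θᶠ ⟧ᵇ (c ∷ⁿ k′ ∷ⁿ s ∷ⁿ x)
θᶠ-mono x c s k≤k′ h s∈T children∈T =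
  let i , i≤k , j , j≤k , coincide = h s∈T λ i i≤k → children∈T i (≤-trans i≤k k≤k′)
  in i , ≤-trans i≤k k≤k′ , j , ≤-trans j≤k k≤k′ , coincide

-- The instance is the table of `θᶠ`. By monotonicity a bound on the number of children is a
-- threshold from which every `k` works; conversely the threshold itself is a bound.
FinBranch≤universal : FinBranch ≤dm unrestricted universal
FinBranch≤universal =
  functional cy ,
  reduction {FinBranch} {unrestricted universal} cy
    (λ (α , x) → ∀∀∞∀-witness (bound α) (tableInstance θᶠ x))
    (λ (α , x) → ∀∃∀-witness (bound α) x)
    (∀∀∞∀-computes image bound-computes) (∀∃∀-computes instanceˢ bound-computes)
    _
    (λ x _ α w → ⊩-∀∀∞∀ (tableInstance θᶠ x) θᵘ (bound α) λ s k k≥ c →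
      table-complete θᶠ x s k c (θᶠ-mono x c s k≥ (proj₂ (w s c))))
    (λ x _ α w → ⊩-∀∃∀ x θᶠ (bound α) λ s c →
      table-sound θᶠ x s (bound α s) c (proj₂ (w s (bound α s) ≤-refl c))) ,
  reduction {dualᴾ FinBranch} {dualᴾ (unrestricted universal)} cy
    -- Every `k` is refuted by some tuple, so the refuted `k ≥ i` can be `i` itself.
    (λ (α , x) → ∃∃∞∃-witness (head α) id (inner α) (tableInstance θᶠ x))
    (λ (α , x) → ∃∀∃-witness (head α) (inner₂ α) x)
    (∃∃∞∃-computes image head-computes newest inner-computes)
    (∃∀∃-computes instanceˢ head-computes inner₂-computes)
    _
    (λ x _ α w → ⊩-∃∃∞∃ (tableInstance θᶠ x) (not θᵘ) (head α) id (inner α)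
      (λ k → ≤-refl) λ k → proj₂ (w k) ∘ table-sound θᶠ x (head α) k (inner α k))
    -- The given witness refutes some number above `k`; by monotonicity the same tuple refutes `k`.
    (λ x _ α w → ⊩-∃∀∃ x (not θᶠ) (head α) (inner₂ α) λ k →
      proj₂ (proj₂ (w k)) ∘ table-complete θᶠ x (head α) (inner α k) (inner₂ α k) ∘
      θᶠ-mono x (inner₂ α k) (head α) (proj₁ (w k)))
  where
  cy = tableInstance-computes θᶠ
  image : Computesˢ withWitness (tableInstance θᶠ ∘ proj₂)
  image = substituteˢ proj₂ instanceˢ cy

-- The tree built from a matrix

spine : ℕ → ℕ
spine = natrec 0 λ _ s → snoc s 0

-- The search bound `s` suffices by `n≤spine`. Off the spine the value is the default `s`; `child`
-- excludes this case by comparing `spine (depth s)` with `s`.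
depth : ℕ → ℕ
depth s = search (λ n → distance (spine n) s) s

-- A code of the tuple `g n , … , g 0`. The reversed order is harmless, since only coincidences
-- among entries matter.
collect : (ℕ → ℕ) → ℕ → ℕ
collect g = natrec (pair (g 0) 0) λ n c → pair (g (suc n)) c

-- These functions represent predicates, with value 0 for truth, except firstHit.
-- The numbers c with legal c ≡ 0 are the children of the node 0ⁿ: the next node
-- of the spine, c = 0, and c = suc (pair i t) where t = pair k m is the first
-- code of a counterexample X(n, k, m) ≢ 0 with k ≥ i.
module _ (X : ℕ → ℕ) (n : ℕ) where

  hit : ℕ → ℕ → ℕ
  hit i t = (i ∸ π₁ t) + negate (X (pair (pair n (π₁ t)) (π₂ t)))

  first : ℕ → ℕ → ℕ
  -- A search up to `t` that returns `t` has met no smaller hit, so `t` alone decides whether it is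
  -- the first one.
  first i t = distance (search (hit i) t) t + hit i t

  legal : ℕ → ℕ
  legal c = ifz c 0 (first (π₁ (pred c)) (π₂ (pred c)))

  -- Singles out the children off the spine that record some `i ≥ k`: each of them carries a
  -- counterexample at or beyond `k`.
  wide : ℕ → ℕ → ℕ
  wide k c = negate c + (legal c + (k ∸ π₁ (pred c)))

  -- One known counterexample `t = pair k m` bounds the search for the child recording `i`, for
  -- every `i ≤ k`; this keeps the search bounded.
  firstHit : ℕ → ℕ → ℕ
  firstHit t i = suc (pair i (search (hit i) t))

child : (ℕ → ℕ) → ℕ → ℕ → ℕ
child X s c = negate (distance (spine (depth s)) s + legal X (depth s) c)

tree : (ℕ → ℕ) → ℕ → ℕ
tree X s = ifz s 1 (join (child X) (pred s))

-- Membership in the tree and the number of children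

snoc-injectiveˡ : ∀ {s c t d} → snoc s c ≡ snoc t d → s ≡ t
snoc-injectiveˡ {s} {c} {t} {d} eq =
  trans (sym (cong proj₁ (unpair-pair s c)))
        (trans (cong π₁ (suc-injective eq)) (cong proj₁ (unpair-pair t d)))

n≤triangle : ∀ n → n ≤ triangle n
n≤triangle zero    = z≤n
n≤triangle (suc n) = m≤m+n (suc n) (triangle n)

m≤pair : ∀ m n → m ≤ pair m n
m≤pair m n = ≤-trans (m≤m+n m n)
  (≤-trans (n≤triangle (m + n)) (m≤m+n (triangle (m + n)) n))

n≤spine : ∀ n → n ≤ spine n
n≤spine zero    = z≤n
n≤spine (suc n) = s≤s (≤-trans (n≤spine n) (m≤pair (spine n) 0))

spine-injective : ∀ m n → spine m ≡ spine n → m ≡ n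
spine-injective zero    zero    eq = refl
spine-injective (suc m) (suc n) eq = cong suc (spine-injective m n (snoc-injectiveˡ eq))

depth-spine : ∀ n → depth (spine n) ≡ n
depth-spine n = search-unique (λ m → distance (spine m) (spine n)) (spine n) (n≤spine n)
  (distance-refl (spine n))
  λ {m} m<n eq → <⇒≢ m<n (spine-injective m n (distance≡0⇒≡ _ _ eq))

drop-pair : ∀ c d i → drop (suc i) (pair c d) ≡ drop i d
drop-pair c d zero    = cong proj₂ (unpair-pair c d)
drop-pair c d (suc i) = cong π₂ (drop-pair c d i)

entry-collect : ∀ g n {i} → i ≤ n → entry (collect g n) i ≡ g (n ∸ i)
entry-collect g zero    {zero}  _  = cong proj₁ (unpair-pair (g 0) 0)
entry-collect g (suc n) {zero}  _  = cong proj₁ (unpair-pair (g (suc n)) (collect g n))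
entry-collect g (suc n) {suc i} i≤ =
  trans (cong π₁ (drop-pair (g (suc n)) (collect g n) i)) (entry-collect g n (s≤s⁻¹ i≤))

module _ (X : ℕ → ℕ) where

  tree-child : ∀ s c → tree X (snoc s c) ≡ child X s c
  tree-child = join-pair (child X)

  tree-child⁻ : ∀ s c → tree X (snoc s c) ≡ 1 → spine (depth s) ≡ s × legal X (depth s) c ≡ 0
  tree-child⁻ s c s∈
    with distance (spine (depth s)) s + legal X (depth s) c in eq
       | trans (sym (tree-child s c)) s∈
  ... | zero | _ = distance≡0⇒≡ _ _ (m+n≡0⇒m≡0 _ eq) , m+n≡0⇒n≡0 (distance (spine (depth s)) s) eq

  tree-child⁺ : ∀ n {c} → legal X n c ≡ 0 → tree X (snoc (spine n) c) ≡ 1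
  tree-child⁺ n {c} ok = trans (tree-child (spine n) c) (cong negate eq)
    where
    eq : distance (spine (depth (spine n))) (spine n) + legal X (depth (spine n)) c ≡ 0
    eq rewrite depth-spine n | distance-refl (spine n) = ok

  tree-spine : ∀ n → tree X (spine n) ≡ 1
  tree-spine zero    = refl
  tree-spine (suc n) = tree-child⁺ n {0} refl

  -- The parent of any member lies on the spine, and the whole spine belongs to the tree.
  tree-isTree : IsTree (tree X)
  tree-isTree = ≤1 , λ σ τ → prefix ⌜ σ ⌝ τ ∘ trans (cong (tree X) (sym (foldl-++ snoc 0 σ τ)))
    where
    negate≤1 : ∀ n → negate n ≤ 1
    negate≤1 zero    = ≤-refl
    negate≤1 (suc n) = z≤n

    ≤1 : ∀ s → tree X s ≤ 1
    ≤1 zero    = ≤-refl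
    ≤1 (suc s) = negate≤1 _

    prefix : ∀ s τ → tree X (foldl snoc s τ) ≡ 1 → tree X s ≡ 1
    prefix s []      s∈ = s∈
    prefix s (c ∷ τ) s∈ = subst (λ s → tree X s ≡ 1)
      (proj₁ (tree-child⁻ s c (prefix (snoc s c) τ s∈)))
      (tree-spine (depth s))

  module _ (n : ℕ) where

    first-unique : ∀ {i t u} → first X n i t ≡ 0 → first X n i u ≡ 0 → t ≡ u
    first-unique {i} {t} {u} ft fu with <-cmp t u
    ... | tri≈ _ eq _ = eq
    ... | tri< t<u _ _ = contradiction
      (m+n≡0⇒n≡0 (distance (search (hit X n i) t) t) ft)
      (search-least (hit X n i) u (subst (t <_) (sym (distance≡0⇒≡ _ _ (m+n≡0⇒m≡0 _ fu))) t<u))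
    ... | tri> _ _ u<t = contradiction
      (m+n≡0⇒n≡0 (distance (search (hit X n i) u) u) fu)
      (search-least (hit X n i) t (subst (u <_) (sym (distance≡0⇒≡ _ _ (m+n≡0⇒m≡0 _ ft))) u<t))

    -- The colouring for the pigeonhole principle: 0 for the child on the spine, `suc i` for a child
    -- recording `i`. It separates legal children because the first hit for `i` is unique.
    rank : ℕ → ℕ
    rank zero    = 0
    rank (suc c) = suc (π₁ c)

    rank-bounded : ∀ k c → legal X n c ≡ 0 → wide X n k c ≢ 0 → rank c < suc k
    rank-bounded k zero    _  _     = s≤s z≤n
    rank-bounded k (suc c) ok ¬wide = s≤s (≰⇒> λ k≤ → ¬wide (cong₂ _+_ ok (m≤n⇒m∸n≡0 k≤)))

    rank-injective : ∀ c d → legal X n c ≡ 0 → legal X n d ≡ 0 → rank c ≡ rank d → c ≡ d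
    rank-injective zero    zero    _   _   _  = refl
    rank-injective (suc c) (suc d) okc okd eq = cong suc (begin
      c                  ≡⟨ pair-unpair c ⟨
      pair (π₁ c) (π₂ c) ≡⟨ cong₂ pair i≡ t≡ ⟩
      pair (π₁ d) (π₂ d) ≡⟨ pair-unpair d ⟩
      d                  ∎)
      where
      open ≡-Reasoning
      i≡ : π₁ c ≡ π₁ d
      i≡ = suc-injective eq
      t≡ : π₂ c ≡ π₂ d
      t≡ = first-unique (subst (λ i → first X n i (π₂ c) ≡ 0) i≡ okc) okd

    wide⇒≢0 : ∀ k c → wide X n k c ≡ 0 → let t = π₂ (pred c) in
              π₁ t ≥ k × X (pair (pair n (π₁ t)) (π₂ t)) ≢ 0
    wide⇒≢0 k (suc c) eq =
      ≤-trans (m∸n≡0⇒m≤n (m+n≡0⇒n≡0 (first X n (π₁ c) t) eq))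
              (m∸n≡0⇒m≤n (m+n≡0⇒m≡0 _ hit≡0)) ,
      negate-sound _ (m+n≡0⇒n≡0 (π₁ c ∸ π₁ t) hit≡0)
      where
      t = π₂ c
      hit≡0 : hit X n (π₁ c) t ≡ 0
      hit≡0 = m+n≡0⇒n≡0 (distance (search (hit X n (π₁ c)) t) t) (m+n≡0⇒m≡0 _ eq)

    -- `pair k m` is a hit for each `i ≤ k`, so the search up to it ends in a hit `r`. Nothing
    -- smaller is a hit, hence the search up to `r` returns `r` again.
    firstHit-legal : ∀ {i k m} → i ≤ k → X (pair (pair n k) m) ≢ 0 →
                     legal X n (firstHit X n (pair k m) i) ≡ 0
    firstHit-legal {i} {k} {m} i≤k ≢0
      rewrite unpair-pair i (search (hit X n i) (pair k m)) =
      cong₂ _+_ (trans (cong (λ u → distance u r) settled) (distance-refl r)) hit-r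
      where
      t = pair k m
      r = search (hit X n i) t
      hit-t : hit X n i t ≡ 0
      hit-t rewrite unpair-pair k m = cong₂ _+_ (m≤n⇒m∸n≡0 i≤k) (negate-complete _ ≢0)
      hit-r : hit X n i r ≡ 0
      hit-r = search-finds (hit X n i) t ≤-refl hit-t
      settled : search (hit X n i) r ≡ r
      settled = search-unique (hit X n i) r ≤-refl hit-r (search-least (hit X n i) t)

    -- A counterexample at `k ≥ K` provides the children recording `0 , … , K`, which already exceed
    -- the bound without the child on the spine.
    many-children : ∀ {K k m} → K ≤ k → X (pair (pair n k) m) ≢ 0 →
      ¬ ⟦ θᶠ ⟧ᵇ (collect (firstHit X n (pair k m)) K ∷ K ∷ spine n ∷ [] , tree X ∷ [])
    many-children {K} {k} {m} K≤k ≢0 h =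
      let i , i≤K , j , j≤K , i≢j , eq = h (tree-spine n) λ i i≤K →
            subst (λ c → tree X (snoc (spine n) c) ≡ 1) (sym (entry-collect g K i≤K))
              (tree-child⁺ n (firstHit-legal (≤-trans (m∸n≤m K i) K≤k) ≢0))
      -- Values of `firstHit` have the form `snoc i r`, so equal entries record equal numbers
      -- `K ∸ i` and `K ∸ j`.
      in i≢j (∸-cancelˡ-≡ i≤K j≤K (snoc-injectiveˡ
           (trans (sym (entry-collect g K i≤K)) (trans eq (entry-collect g K j≤K)))))
      where
      g = firstHit X n (pair k m)

  -- Without wide entries, all `k + 2` children have ranks among `0 , … , k`, so two of them share a
  -- rank and coincide.
  few-children : ∀ s k c → (∀ {j} → j ≤ suc k → wide X (depth s) k (entry c j) ≢ 0) →
                 ⟦ θᶠ ⟧ᵇ (c ∷ suc k ∷ s ∷ [] , tree X ∷ [])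
  few-children s k c ¬wide _ children∈ =
    let i , j , i<j , eq = pigeonhole ≤-refl colour
    in toℕ i , ≤k i , toℕ j , ≤k j , <⇒≢ i<j ,
       rank-injective n _ _ (ok i) (ok j)
         (trans (sym (toℕ-fromℕ< _)) (trans (cong toℕ eq) (toℕ-fromℕ< _)))
    where
    n = depth s
    ≤k : (i : Fin (2 + k)) → toℕ i ≤ suc k
    ≤k i = s≤s⁻¹ (toℕ<n i)
    ok : (i : Fin (2 + k)) → legal X n (entry c (toℕ i)) ≡ 0
    ok i = proj₂ (tree-child⁻ s (entry c (toℕ i)) (children∈ (toℕ i) (≤k i)))
    colour : Fin (2 + k) → Fin (1 + k)
    colour i = fromℕ< (rank-bounded n k (entry c (toℕ i)) (ok i) (¬wide (≤k i)))

-- Computability of the tree construction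

module _ {Γ : E → Space p q} where

  weaken₁ : {F : E → ℕ → ℕ} → Computes₁ Γ F → Computes₁ (Γ ▹) (F ∘ proj₁)
  weaken₁ = substitute (λ ((e , _) , n) → e , n) (consˢ newest weakening²ˢ)

  spine-computes : {n : E → ℕ} → Computes Γ n → Computes Γ λ e → spine (n e)
  spine-computes = natrec-computes (constant 0) (app₂ snoc snoc-pr (weaken newest) (constant 0))

module _ {Γ : E → Space p q} where

  depth-computes : {s : E → ℕ} → Computes Γ s → Computes Γ λ e → depth (s e)
  depth-computes cs =
    search-computes (distance-computes (spine-computes newest) (weaken cs)) cs

  collect-computes : {g : E → ℕ → ℕ} {n : E → ℕ} → Computes₁ Γ g → Computes Γ n →
                     Computes Γ λ e → collect (g e) (n e)
  collect-computes cg = natrec-computes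
    (app₂ pair pair-pr (apply cg (constant 0)) (constant 0))
    (app₂ pair pair-pr (apply (weaken₁ (weaken₁ cg)) (app₁ suc suc newest)) (weaken newest))

  hit-computes : {X : E → ℕ → ℕ} {n i t : E → ℕ} →
                 Computes₁ Γ X → Computes Γ n → Computes Γ i → Computes Γ t →
                 Computes Γ λ e → hit (X e) (n e) (i e) (t e)
  hit-computes cX cn ci ct = app₂ _+_ +-pr (app₂ _∸_ ∸-pr ci (app₁ π₁ π₁-pr ct))
    (negate-computes (apply cX (app₂ pair pair-pr
      (app₂ pair pair-pr cn (app₁ π₁ π₁-pr ct)) (app₁ π₂ π₂-pr ct))))

module _ {Γ : E → Space p q} {X : E → ℕ → ℕ} {n : E → ℕ}
         (cX : Computes₁ Γ X) (cn : Computes Γ n) where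

  searchHit-computes : {i t : E → ℕ} → Computes Γ i → Computes Γ t →
                       Computes Γ λ e → search (hit (X e) (n e) (i e)) (t e)
  searchHit-computes ci = search-computes (hit-computes (weaken₁ cX) (weaken cn) (weaken ci) newest)

  legal-computes : {c : E → ℕ} → Computes Γ c → Computes Γ λ e → legal (X e) (n e) (c e)
  legal-computes {c} cc = ifz-computes cc (constant 0) (app₂ _+_ +-pr
      (distance-computes (searchHit-computes ci ct) ct) (hit-computes cX cn ci ct))
    where
    ci : Computes Γ λ e → π₁ (pred (c e))
    ci = app₁ π₁ π₁-pr (app₁ pred pred-pr cc)
    ct : Computes Γ λ e → π₂ (pred (c e))
    ct = app₁ π₂ π₂-pr (app₁ pred pred-pr cc)

  wide-computes : {k c : E → ℕ} → Computes Γ k → Computes Γ c →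
                  Computes Γ λ e → wide (X e) (n e) (k e) (c e)
  wide-computes ck cc = app₂ _+_ +-pr (negate-computes cc) (app₂ _+_ +-pr (legal-computes cc)
    (app₂ _∸_ ∸-pr ck (app₁ π₁ π₁-pr (app₁ pred pred-pr cc))))

firstHit-computes : {Γ : E → Space p q} {X : E → ℕ → ℕ} {n t : E → ℕ} →
                    Computes₁ Γ X → Computes Γ n → Computes Γ t →
                    Computes₁ Γ λ e → firstHit (X e) (n e) (t e)
firstHit-computes cX cn ct = app₁ suc suc (app₂ pair pair-pr newest
  (searchHit-computes (weaken₁ cX) (weaken cn) newest (weaken ct)))

tree-computes : {Γ : E → Space p q} {X : E → ℕ → ℕ} → Computes₁ Γ X →
                Computes₁ Γ λ e → tree (X e)
tree-computes {Γ = Γ} {X} cX = ifz-computes newest (constant 1)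
  (apply (weaken₁ (join-computes child-computes)) (app₁ pred pred-pr newest))
  where
  child-computes : Computes₁ (Γ ▹) λ (e , s) → child (X e) s
  child-computes = negate-computes (app₂ _+_ +-pr
    (distance-computes (spine-computes (depth-computes (weaken newest))) (weaken newest))
    (legal-computes (weaken₁ (weaken₁ cX)) (depth-computes (weaken newest)) newest))

-- Reduction of the complete formula to `FinBranch`

matrixFunction : Space 0 1 → ℕ → ℕ
matrixFunction x = lookup (proj₂ x) 0F

treeInstance : Space 0 1 → Space 0 1
treeInstance x = [] , tree (matrixFunction x) ∷ []

treeInstance-computes : Computesˢ id treeInstance
treeInstance-computes = (λ ()) & λ { 0F → tree-computes (functions identityˢ 0F) }

-- The K + 1 children that refute the bound K, and the counterexample read off
-- the K + 2 children that refute the bound K + 1.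
refutation : (ℕ → ℕ) × Space 0 1 → ℕ → ℕ
refutation (α , x) K = collect
  (firstHit (matrixFunction x) (head α) (pair (inner α K) (inner₂ α K))) K

deepChild counterexample : (ℕ → ℕ) × Space 0 1 → ℕ → ℕ
deepChild (α , x) K = entry (inner α (suc K))
  (search (λ j → wide (matrixFunction x) (depth (head α)) K (entry (inner α (suc K)) j)) (suc K))
counterexample e K = π₂ (pred (deepChild e K))

universal≤FinBranch : unrestricted universal ≤dm FinBranch
universal≤FinBranch =
  functional cy ,
  reduction {unrestricted universal} {FinBranch} cy
    -- The successor accounts for the child on the spine.
    (λ (α , x) → ∀∃∀-witness (λ s → suc (bound α (depth s))) (treeInstance x))
    (λ (α , x) → ∀∀∞∀-witness (λ n → bound α (spine n)) x)
    (∀∃∀-computes image (app₁ suc suc (apply (weaken₁ bound-computes) (depth-computes newest))))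
    (∀∀∞∀-computes instanceˢ (apply (weaken₁ bound-computes) (spine-computes newest)))
    (λ x _ → tree-isTree (matrixFunction x))
    (λ x _ α w → ⊩-∀∃∀ (treeInstance x) θᶠ (λ s → suc (bound α (depth s))) λ s c →
      few-children (matrixFunction x) s (bound α (depth s)) c λ {j} _ wide≡0 →
        let k≤ , ≢0 = wide⇒≢0 (matrixFunction x) (depth s) (bound α (depth s)) (entry c j) wide≡0
        in ≢0 (proj₂ (w (depth s) _ k≤ _)))
    (λ x _ α w → ⊩-∀∀∞∀ x θᵘ (λ n → bound α (spine n)) λ n k k≥ m →
      -- A nonzero value at or beyond the bound would produce more children of `spine n` than the
      -- bound allows.
      decidable-stable (_ ≟ 0) λ ≢0 →
        many-children (matrixFunction x) n {bound α (spine n)} {k} {m} k≥ ≢0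
          (proj₂ (w (spine n)
            (collect (firstHit (matrixFunction x) n (pair k m)) (bound α (spine n)))))) ,
  reduction {dualᴾ (unrestricted universal)} {dualᴾ FinBranch} cy
    (λ e → ∃∀∃-witness (spine (head (proj₁ e))) (refutation e) (treeInstance (proj₂ e)))
    (λ e → ∃∃∞∃-witness (depth (head (proj₁ e)))
      (λ K → π₁ (counterexample e K)) (λ K → π₂ (counterexample e K)) (proj₂ e))
    (∃∀∃-computes image (spine-computes head-computes) refutation-computes)
    (∃∃∞∃-computes instanceˢ (depth-computes head-computes)
      (app₁ π₁ π₁-pr counterexample-computes) (app₁ π₂ π₂-pr counterexample-computes))
    (λ x _ → tree-isTree (matrixFunction x))
    (λ x _ α w → ⊩-∃∀∃ (treeInstance x) (not θᶠ) (spine (head α)) (refutation (α , x)) λ K →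
      many-children (matrixFunction x) (head α) (proj₁ (w K)) (proj₂ (proj₂ (w K))))
    (λ x _ α w → ⊩-∃∃∞∃ x (not θᵘ) (depth (head α))
      (λ K → π₁ (counterexample (α , x) K)) (λ K → π₂ (counterexample (α , x) K))
      (λ K → proj₁ (found x α w K)) (λ K → proj₂ (found x α w K)))
  where
  cy = treeInstance-computes
  image : Computesˢ withWitness (treeInstance ∘ proj₂)
  image = substituteˢ proj₂ instanceˢ cy

  matrix-computes : Computes₁ withWitness (matrixFunction ∘ proj₂)
  matrix-computes = functions instanceˢ 0F

  refutation-computes : Computes₁ withWitness refutation
  refutation-computes = collect-computes
    (firstHit-computes (weaken₁ matrix-computes) (weaken head-computes)
      (app₂ pair pair-pr inner-computes inner₂-computes))
    newest

  counterexample-computes : Computes₁ withWitness counterexample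
  counterexample-computes = app₁ π₂ π₂-pr (app₁ pred pred-pr (app₂ entry entry-pr
    tuple-computes
    (search-computes
      (wide-computes (weaken₁ (weaken₁ matrix-computes))
        (weaken (weaken (depth-computes head-computes)))
        (weaken newest) (app₂ entry entry-pr (weaken tuple-computes) newest))
      (app₁ suc suc newest))))
    where
    tuple-computes : Computes₁ withWitness λ (α , _) K → inner α (suc K)
    tuple-computes = apply (weaken₁ inner-computes) (app₁ suc suc newest)

  -- If the search ended at a child that is not wide, no entry would be wide, and `few-children`
  -- would contradict the witness against the bound `suc K`. So a wide child is found, and its
  -- counterexample lies at or beyond `K`.
  found : ∀ x α → α ⊩ dual finBranch at treeInstance x → ∀ K →
          let t = counterexample (α , x) K in
          π₁ t ≥ K × matrixFunction x (pair (pair (depth (head α)) (π₁ t)) (π₂ t)) ≢ 0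
  found x α w K = wide⇒≢0 X (depth s) K (deepChild (α , x) K)
    (decidable-stable (_ ≟ 0) λ ≢0 → proj₂ (w (suc K)) (few-children X s K (inner α (suc K))
      λ j≤ wide≡0 →
      ≢0 (search-finds (λ j → wide X (depth s) K (entry (inner α (suc K)) j)) (suc K) j≤ wide≡0)))
    where
    X = matrixFunction x
    s = head α

proposition3p4 : Dicomplete (∀′ ∷ ∀∞ ∷ ∀′ ∷ []) FinBranch
proposition3p4 =
  0 , 1 , universal , universal-strictlyDicomplete , FinBranch≤universal , universal≤FinBranch
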